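{- Let $p>3$ be a prime, $\delta\in\{\pm1\}$, and $$T_p(2,5\delta,2)=\prod_{\substack{i,j=1\\ p\nmid 2i^2+5\delta ij+2j^2}}^{(p-1)/2}(2i^2+5\delta ij+2j^2).$$ If $p\equiv1\pmod4$, then $T_p(2,5\delta,2)\equiv(-1)^{\lfloor(p+11)/12\rfloor}\pmod p$. If $p\equiv3\pmod4$, then $$T_p(2,5\delta,2)\equiv\left(\frac{6}{p}\right)\frac{\delta\,2^\delta}{3^\delta}\binom{(p-3)/2}{(p-3)/4}^{ -2\delta}\pmod p.$$
   Context: $\left(\frac{\cdot}{p}\right)$ is the Legendre symbol; fractions and negative powers in a congruence modulo $p$ denote multiplication by inverses modulo $p$. -}

module Defs where

open import Data.Nat as ℕ using (ℕ; _∸_)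
open import Data.Nat.Divisibility as ℕD using (_∣?_)
open import Data.Integer as ℤ using (ℤ; +_; -_; _*_; _+_; _-_; ∣_∣)
open import Data.Integer.Divisibility as ℤD using ()
open import Data.List as L using (List; upTo; map; concatMap; foldr)
open import Data.List.Relation.Unary.Any using (any?)
open import Relation.Nullary.Decidable using (does)
open import Data.Bool using (if_then_else_)

infix 4 _≡_[mod_]
_≡_[mod_] : ℤ → ℤ → ℕ → Set
a ≡ b [mod p ] = (+ p) ℤD.∣ (a - b)

prodℤ : List ℤ → ℤ
prodℤ = foldr _*_ (+ 1)

range1 : ℕ → List ℕ
range1 n = map ℕ.suc (upTo n)

form : ℤ → ℕ → ℕ → ℤ
form δ i j = (+ 2) * (+ i) * (+ i) + (+ 5) * δ * (+ i) * (+ j) + (+ 2) * (+ j) * (+ j)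

factor : ℕ → ℤ → ℕ → ℕ → ℤ
factor p δ i j = if does (p ∣? ∣ form δ i j ∣) then + 1 else form δ i j

T : ℕ → ℤ → ℤ
T p δ = prodℤ (concatMap (λ i → map (λ j → factor p δ i j) (range1 h)) (range1 h))
  where h = (p ∸ 1) ℕ./ 2

legendre : ℤ → ℕ → ℤ
legendre a p =
  if does (p ∣? ∣ a ∣) then + 0
  else if does (any? (λ x → p ∣? ∣ (+ x) * (+ x) - a ∣) (upTo p)) then + 1
  else - (+ 1)

{-# OPTIONS --safe #-}
-- Put n = (p-1)/2, m = ⌊n/2⌋ and u(i,j) = 2i + δj.  The form equals δ u(i,j) u(j,i), and when u(i,j)
-- vanishes mod p the other factor δ u(j,i) is -3i; multiplying over the square 1 ≤ i,j ≤ n therefore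
-- gives T · (∏ -3i)² = δⁿ (∏ u)², with -3i over the zeros of u and the product ∏ u over its nonzero
-- values.  Only squares of rows ∏ⱼ u(i,j) matter.  As 2i is ± some s ≤ n, such a row is the product
-- of the j + s or of the nonzero j - s, and with Wilson's theorem both are expressed through
-- E(s) = s! (n-s)!, the even and odd s contributing on opposite sides.  The symmetries of E make
-- everything cancel except powers of 2 and 3 and, for n = 2m+1, the number m!, for which
-- (2m)!² ≡ 4 yields the central binomial coefficient.
-- If n = 2m, then T · 3ⁿ ≡ -2ⁿ, and the two powers are evaluated as in Gauss's lemma.
-- Wilson's and Fermat's theorems and Euler's criterion all come from one argument: pairing x with
-- a/x in (p-1)!.
module Submission where

open import Defs
open import Data.Nat as ℕ using (ℕ; _∸_; _%_; _/_; _>_)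
open import Data.Nat.Primality using (Prime)
open import Data.Nat.Combinatorics using (_C_)
open import Data.Integer as ℤ using (ℤ; +_; -_; _*_; _^_)
open import Data.Sum using (_⊎_)
open import Data.Product using (_×_)
open import Relation.Binary.PropositionalEquality using (_≡_)

open import Data.Bool.Base using (if_then_else_)
open import Data.Integer using (_+_; _-_; ∣_∣)
import Data.Integer.DivMod as ℤDM
import Data.Integer.Divisibility.Signed as Signed
import Data.Integer.Properties as ℤP
open import Data.Integer.Tactic.RingSolver using (solve-∀)
open import Data.List.Base as List using (List; []; _∷_; map; upTo; applyUpTo; length; downFrom)
open import Data.List.Membership.Propositional as Membership using (_∈_)
open import Data.List.Membership.Propositional.Properties
  using (∈-∃++; ∈-map⁺; ∈-map⁻; ∈-downFrom⁺; ∈-downFrom⁻; ∈-upTo⁺; ∈-upTo⁻)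
import Data.List.Properties as ListP
open import Data.List.Relation.Binary.Permutation.Propositional
  using (_↭_; ↭-trans; ↭-sym; prep; ↭⇒↭ₛ)
open import Data.List.Relation.Binary.Permutation.Propositional.Properties
  using (∈-resp-↭; ↭-length; shift)
import Data.List.Relation.Binary.Permutation.Setoid.Properties as PermutationP
open import Data.List.Relation.Unary.All as All using ()
open import Data.List.Relation.Unary.AllPairs using (_∷_)
open import Data.List.Relation.Unary.Any using (any?; here; there)
open import Data.List.Relation.Unary.Unique.Propositional using (Unique)
import Data.List.Relation.Unary.Unique.Propositional.Properties as UniqueP
open import Data.Nat using (zero; suc; _!)
open import Data.Nat.Combinatorics using (nCk≡n!/k![n-k]!; k![n∸k]!∣n!)
open import Data.Nat.Coprimality using (prime⇒coprime; coprime-Bézout)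
import Data.Nat.Divisibility as ℕD
open import Data.Nat.DivMod using (m*n/n≡m; m/n*n≡m; m≡m%n+[m/n]*n; m%n<n; +-distrib-/-∣ʳ)
import Data.Nat.GCD as GCD
open import Data.Nat.ListAction using (product)
open import Data.Nat.ListAction.Properties using (product-↭)
open import Data.Nat.Primality using (euclidsLemma; prime⇒nonZero; prime⇒irreducible; ¬prime[1])
import Data.Nat.Properties as ℕP
import Data.Nat.Tactic.RingSolver as ℕSolver
open import Data.Product using (_,_; ∃; proj₂)
open import Data.Sum using (inj₁; inj₂)
open import Function.Base using (_∘_)
open import Relation.Binary using (Setoid)
import Relation.Binary.Reasoning.Setoid as SetoidReasoning
open import Relation.Binary.PropositionalEquality
  using (_≢_; refl; sym; trans; cong; cong₂; subst; subst₂; setoid; module ≡-Reasoning)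
open import Relation.Nullary using (¬_; Dec; yes; no; does; contradiction)

-- Finite products

-- The number -3i comes from the identity δ u(j,i) = 2 u(i,j) - 3i, valid because δ² = 1.
--
-- Squaring is what keeps the computation short. T enters linearly, but every quantity multiplied
-- with it is a square, so the signs of the rows, and the sign in a! b! ≡ ±1 for a + b = p - 1,
-- never have to be followed.
--
-- Why E(s): the product of the j + s is (n+s)!/s!, and Wilson's theorem makes (n+s)! the inverse of
-- (n-s)! up to sign, so the row squares to E(s)⁻². The nonzero j - s multiply to ±(s-1)! (n-s)!, so
-- that row squares to (E(s)/s)².
--
-- Why p modulo 4 decides the shape of the answer: the reflection s ↦ n - s preserves the parity of
-- s when n is even and exchanges the parities when n is odd. In the second case E(n) = n! is left
-- without a partner.
--
-- In evaluating T no inverse is formed: denominators are multiplied onto the left-hand side, and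
-- units are cancelled when two such identities are compared.

∏ : ℕ → (ℕ → ℤ) → ℤ
∏ zero    f = + 1
∏ (suc n) f = f 0 * ∏ n (f ∘ suc)

*-interchange : ∀ a b c d → (a * b) * (c * d) ≡ (a * c) * (b * d)
*-interchange = solve-∀

∏-cong-≡ : ∀ n {f g} → (∀ i → f i ≡ g i) → ∏ n f ≡ ∏ n g
∏-cong-≡ zero    f≡g = refl
∏-cong-≡ (suc n) f≡g = cong₂ _*_ (f≡g 0) (∏-cong-≡ n (f≡g ∘ suc))

∏-distrib-* : ∀ n f g → ∏ n (λ i → f i * g i) ≡ ∏ n f * ∏ n g
∏-distrib-* zero    f g = refl
∏-distrib-* (suc n) f g = begin
  f 0 * g 0 * ∏ n (λ i → f (suc i) * g (suc i))    ≡⟨ cong (f 0 * g 0 *_) (∏-distrib-* n (f ∘ suc) (g ∘ suc)) ⟩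
  f 0 * g 0 * (∏ n (f ∘ suc) * ∏ n (g ∘ suc))      ≡⟨ *-interchange (f 0) (g 0) _ _ ⟩
  f 0 * ∏ n (f ∘ suc) * (g 0 * ∏ n (g ∘ suc))      ∎
  where open ≡-Reasoning

∏-const : ∀ n c → ∏ n (λ _ → c) ≡ c ^ n
∏-const zero    c = refl
∏-const (suc n) c = cong (c *_) (∏-const n c)

∏-one : ∀ n → ∏ n (λ _ → + 1) ≡ + 1
∏-one n = trans (∏-const n (+ 1)) (ℤP.^-zeroˡ n)

∏-+ : ∀ m n f → ∏ (m ℕ.+ n) f ≡ ∏ m f * ∏ n (λ i → f (m ℕ.+ i))
∏-+ zero    n f = sym (ℤP.*-identityˡ _)
∏-+ (suc m) n f = trans (cong (f 0 *_) (∏-+ m n (f ∘ suc))) (sym (ℤP.*-assoc (f 0) _ _))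

∏-last : ∀ n f → ∏ (suc n) f ≡ ∏ n f * f n
∏-last zero    f = ℤP.*-comm (f 0) (+ 1)
∏-last (suc n) f = trans (cong (f 0 *_) (∏-last n (f ∘ suc))) (sym (ℤP.*-assoc (f 0) _ _))

-- Describing mirror indices by an equation rather than by `n ∸ suc i` lets callers match on it with
-- `refl` and avoids truncated subtraction.
∏-reverse : ∀ n f g → (∀ i j → suc (i ℕ.+ j) ≡ n → f i ≡ g j) → ∏ n f ≡ ∏ n g
∏-reverse zero    f g eq = refl
∏-reverse (suc n) f g eq = begin
  f 0 * ∏ n (f ∘ suc) ≡⟨ cong₂ _*_ (eq 0 n refl) (∏-reverse n (f ∘ suc) g (λ i j i+j → eq (suc i) j (cong suc i+j))) ⟩
  g n * ∏ n g         ≡⟨ ℤP.*-comm (g n) _ ⟩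
  ∏ n g * g n         ≡⟨ ∏-last n g ⟨
  ∏ (suc n) g         ∎
  where open ≡-Reasoning

∏-swap : ∀ m n (f : ℕ → ℕ → ℤ) → ∏ m (λ i → ∏ n (f i)) ≡ ∏ n (λ j → ∏ m (λ i → f i j))
∏-swap zero    n f = sym (∏-one n)
∏-swap (suc m) n f = begin
  ∏ n (f 0) * ∏ m (λ i → ∏ n (f (suc i)))          ≡⟨ cong (∏ n (f 0) *_) (∏-swap m n (f ∘ suc)) ⟩
  ∏ n (f 0) * ∏ n (λ j → ∏ m (λ i → f (suc i) j))  ≡⟨ ∏-distrib-* n (f 0) _ ⟨
  ∏ n (λ j → f 0 j * ∏ m (λ i → f (suc i) j))      ∎
  where open ≡-Reasoning

∏-! : ∀ n → ∏ n (λ i → + suc i) ≡ + (n !)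
∏-! zero    = refl
∏-! (suc n) = begin
  ∏ (suc n) (λ i → + suc i)  ≡⟨ ∏-last n (λ i → + suc i) ⟩
  ∏ n (λ i → + suc i) * + suc n ≡⟨ cong (_* + suc n) (∏-! n) ⟩
  + (n !) * + suc n             ≡⟨ ℤP.*-comm (+ (n !)) _ ⟩
  + suc n * + (n !)             ≡⟨ ℤP.pos-* (suc n) (n !) ⟨
  + (suc n !)                   ∎
  where open ≡-Reasoning

suc-! : ∀ n → + (suc n !) ≡ + suc n * + (n !)
suc-! n = ℤP.pos-* (suc n) (n !)

prodℤ-++ : ∀ xs ys → prodℤ (xs List.++ ys) ≡ prodℤ xs * prodℤ ys
prodℤ-++ []       ys = sym (ℤP.*-identityˡ _)
prodℤ-++ (x ∷ xs) ys = trans (cong (x *_) (prodℤ-++ xs ys)) (sym (ℤP.*-assoc x _ _))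

prodℤ-applyUpTo : ∀ n f → prodℤ (applyUpTo f n) ≡ ∏ n f
prodℤ-applyUpTo zero    f = refl
prodℤ-applyUpTo (suc n) f = cong (f 0 *_) (prodℤ-applyUpTo n (f ∘ suc))

map-range1 : ∀ {A : Set} (f : ℕ → A) n → map f (range1 n) ≡ applyUpTo (f ∘ suc) n
map-range1 f n = trans (cong (map f) (ListP.map-upTo suc n)) (ListP.map-applyUpTo suc f n)

prodℤ-concat : ∀ xss → prodℤ (List.concat xss) ≡ prodℤ (map prodℤ xss)
prodℤ-concat []         = refl
prodℤ-concat (xs ∷ xss) = trans (prodℤ-++ xs _) (cong (prodℤ xs *_) (prodℤ-concat xss))

T-∏ : ∀ p δ n → (p ∸ 1) / 2 ≡ n → T p δ ≡ ∏ n (λ i → ∏ n (λ j → factor p δ (suc i) (suc j)))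
T-∏ p δ n refl = begin
  prodℤ (List.concat (map rows (range1 n)))   ≡⟨ prodℤ-concat (map rows (range1 n)) ⟩
  prodℤ (map prodℤ (map rows (range1 n)))     ≡⟨ cong prodℤ (ListP.map-∘ (range1 n)) ⟨
  prodℤ (map (prodℤ ∘ rows) (range1 n))       ≡⟨ cong prodℤ (map-range1 (prodℤ ∘ rows) n) ⟩
  prodℤ (applyUpTo (prodℤ ∘ rows ∘ suc) n)    ≡⟨ prodℤ-applyUpTo n _ ⟩
  ∏ n (prodℤ ∘ rows ∘ suc)                    ≡⟨ ∏-cong-≡ n (λ i → trans (cong prodℤ (map-range1 (factor p δ (suc i)) n)) (prodℤ-applyUpTo n _)) ⟩
  ∏ n (λ i → ∏ n (λ j → factor p δ (suc i) (suc j))) ∎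
  where
  open ≡-Reasoning
  rows : ℕ → List ℤ
  rows i = map (factor p δ i) (range1 n)

^-distribʳ-* : ∀ n a b → (a * b) ^ n ≡ a ^ n * b ^ n
^-distribʳ-* zero    a b = refl
^-distribʳ-* (suc n) a b = trans (cong (a * b *_) (^-distribʳ-* n a b)) (*-interchange a b (a ^ n) (b ^ n))

-- Congruences

module Congruence (p : ℕ) where

  -- The proofs are opaque because with-abstraction would normalise them.
  infix 4 _≈_ _≉_
  -- A record, so that both sides can be inferred from the type of a proof.
  record _≈_ (a b : ℤ) : Set where
    constructor cong-mod
    field p∣difference : + p Signed.∣ a - b

  open _≈_

  _≉_ : ℤ → ℤ → Set
  a ≉ b = ¬ (a ≈ b)

  opaque
    ≈⇒≡[mod] : ∀ {a b} → a ≈ b → a ≡ b [mod p ]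
    ≈⇒≡[mod] = Signed.∣⇒∣ᵤ ∘ p∣difference

    ≡[mod]⇒≈ : ∀ {a b} → a ≡ b [mod p ] → a ≈ b
    ≡[mod]⇒≈ = cong-mod ∘ Signed.∣ᵤ⇒∣

  private
    by : ∀ {c} a b → a - b ≡ c → + p Signed.∣ c → a ≈ b
    by a b eq d = cong-mod (subst (+ p Signed.∣_) (sym eq) d)

  opaque
    ≈-refl : ∀ {a} → a ≈ a
    ≈-refl {a} = by a a (ℤP.+-inverseʳ a) (Signed.divides (+ 0) refl)

    ≈-reflexive : ∀ {a b} → a ≡ b → a ≈ b
    ≈-reflexive refl = ≈-refl

    ≈-sym : ∀ {a b} → a ≈ b → b ≈ a
    ≈-sym {a} {b} (cong-mod d) = by b a (identity a b) (Signed.∣m⇒∣-m d)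
      where
      identity : ∀ a b → b - a ≡ - (a - b)
      identity = solve-∀

    ≈-trans : ∀ {a b c} → a ≈ b → b ≈ c → a ≈ c
    ≈-trans {a} {b} {c} (cong-mod d) (cong-mod e) = by a c (identity a b c) (Signed.∣m∣n⇒∣m+n d e)
      where
      identity : ∀ a b c → a - c ≡ (a - b) + (b - c)
      identity = solve-∀

  ≈-setoid : Setoid _ _
  ≈-setoid = record
    { _≈_ = _≈_
    ; isEquivalence = record { refl = ≈-refl ; sym = ≈-sym ; trans = ≈-trans }
    }

  module ≈-Reasoning = SetoidReasoning ≈-setoid

  opaque
    +-cong : ∀ {a b c d} → a ≈ b → c ≈ d → a + c ≈ b + d
    +-cong {a} {b} {c} {d} (cong-mod e) (cong-mod f) =
      by (a + c) (b + d) (identity a b c d) (Signed.∣m∣n⇒∣m+n e f)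
      where
      identity : ∀ a b c d → (a + c) - (b + d) ≡ (a - b) + (c - d)
      identity = solve-∀

    *-cong : ∀ {a b c d} → a ≈ b → c ≈ d → a * c ≈ b * d
    *-cong {a} {b} {c} {d} (cong-mod e) (cong-mod f) =
      by (a * c) (b * d) (identity a b c d)
        (Signed.∣m∣n⇒∣m+n (Signed.∣m⇒∣m*n c e) (Signed.∣n⇒∣m*n b f))
      where
      identity : ∀ a b c d → a * c - b * d ≡ (a - b) * c + b * (c - d)
      identity = solve-∀

  *-congˡ : ∀ a {b c} → b ≈ c → a * b ≈ a * c
  *-congˡ a = *-cong (≈-refl {a})

  *-congʳ : ∀ a {b c} → b ≈ c → b * a ≈ c * a
  *-congʳ a b≈c = *-cong b≈c (≈-refl {a})

  opaque
    -‿cong : ∀ {a b} → a ≈ b → - a ≈ - b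
    -‿cong {a} {b} (cong-mod d) = by (- a) (- b) (identity a b) (Signed.∣m⇒∣-m d)
      where
      identity : ∀ a b → - a - - b ≡ - (a - b)
      identity = solve-∀

  ^-cong : ∀ n {a b} → a ≈ b → a ^ n ≈ b ^ n
  ^-cong zero    a≈b = ≈-refl
  ^-cong (suc n) a≈b = *-cong a≈b (^-cong n a≈b)

  ∏-cong : ∀ n {f g} → (∀ i → i ℕ.< n → f i ≈ g i) → ∏ n f ≈ ∏ n g
  ∏-cong zero    f≈g = ≈-refl
  ∏-cong (suc n) f≈g = *-cong (f≈g 0 (ℕ.s≤s ℕ.z≤n)) (∏-cong n (λ i i<n → f≈g (suc i) (ℕ.s≤s i<n)))

  ∏-ones : ∀ n {f} → (∀ i → i ℕ.< n → f i ≈ + 1) → ∏ n f ≈ + 1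
  ∏-ones n f≈1 = ≈-trans (∏-cong n f≈1) (≈-reflexive (∏-one n))

  ∏-single : ∀ n k {f} → k ℕ.< n → (∀ i → i ℕ.< n → i ≢ k → f i ≈ + 1) → ∏ n f ≈ f k
  ∏-single (suc n) zero {f} _ f≈1 = begin
    f 0 * ∏ n (f ∘ suc) ≈⟨ *-congˡ (f 0) (∏-ones n (λ i i<n → f≈1 (suc i) (ℕ.s≤s i<n) λ ())) ⟩
    f 0 * + 1           ≡⟨ ℤP.*-identityʳ (f 0) ⟩
    f 0                 ∎
    where open ≈-Reasoning
  ∏-single (suc n) (suc k) {f} (ℕ.s≤s k<n) f≈1 = begin
    f 0 * ∏ n (f ∘ suc) ≈⟨ *-cong (f≈1 0 (ℕ.s≤s ℕ.z≤n) λ ())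
                                  (∏-single n k k<n (λ i i<n i≢k → f≈1 (suc i) (ℕ.s≤s i<n) (i≢k ∘ ℕP.suc-injective))) ⟩
    + 1 * f (suc k)     ≡⟨ ℤP.*-identityˡ _ ⟩
    f (suc k)           ∎
    where open ≈-Reasoning

  ≈0⇒∣ : ∀ {a} → a ≈ + 0 → p ℕD.∣ ∣ a ∣
  ≈0⇒∣ {a} = subst (λ b → p ℕD.∣ ∣ b ∣) (ℤP.+-identityʳ a) ∘ ≈⇒≡[mod]

  ∣⇒≈0 : ∀ {a} → p ℕD.∣ ∣ a ∣ → a ≈ + 0
  ∣⇒≈0 {a} = ≡[mod]⇒≈ ∘ subst (λ b → p ℕD.∣ ∣ b ∣) (sym (ℤP.+-identityʳ a))

  p≈0 : + p ≈ + 0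
  p≈0 = ∣⇒≈0 ℕD.∣-refl

  ≈⇒-≈0 : ∀ {a b} → a ≈ b → a - b ≈ + 0
  ≈⇒-≈0 = ∣⇒≈0 ∘ ≈⇒≡[mod]

  -≈0⇒≈ : ∀ {a b} → a - b ≈ + 0 → a ≈ b
  -≈0⇒≈ = ≡[mod]⇒≈ ∘ ≈0⇒∣

  small≉0 : ∀ {x} → 0 ℕ.< x → x ℕ.< p → + x ≉ + 0
  small≉0 {suc x} _ x<p x≈0 = ℕP.<⇒≱ x<p (ℕD.∣⇒≤ (≈0⇒∣ x≈0))

  private
    ordered-injective : ∀ {x y} → y ℕ.< p → x ℕ.≤ y → + y ≈ + x → x ≡ y
    ordered-injective {x} {y} y<p x≤y y≈x with y ∸ x in eq
    ... | zero  = ℕP.≤-antisym x≤y (ℕP.m∸n≡0⇒m≤n eq)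
    ... | suc d = contradiction (subst (_≈ + 0) difference (≈⇒-≈0 y≈x))
                    (small≉0 (ℕ.s≤s ℕ.z≤n) (subst (ℕ._< p) eq (ℕP.≤-<-trans (ℕP.m∸n≤m y x) y<p)))
      where
      difference : + y - + x ≡ + suc d
      difference = trans (ℤP.m-n≡m⊖n y x) (trans (ℤP.⊖-≥ x≤y) (cong +_ eq))

  opaque
    small-injective : ∀ {x y} → x ℕ.< p → y ℕ.< p → + x ≈ + y → x ≡ y
    small-injective {x} {y} x<p y<p x≈y with ℕP.≤-total x y
    ... | inj₁ x≤y = ordered-injective y<p x≤y (≈-sym x≈y)
    ... | inj₂ y≤x = sym (ordered-injective x<p y≤x x≈y)

module PrimeModulus (p : ℕ) (prime : Prime p) where
  open Congruence p public

  1≉0 : + 1 ≉ + 0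
  1≉0 1≈0 = ¬prime[1] (subst Prime (ℕD.∣1⇒≡1 (≈0⇒∣ 1≈0)) prime)

  opaque
    *≈0 : ∀ {a b} → a * b ≈ + 0 → a ≈ + 0 ⊎ b ≈ + 0
    *≈0 {a} {b} ab≈0 with euclidsLemma ∣ a ∣ ∣ b ∣ prime (subst (p ℕD.∣_) (ℤP.abs-* a b) (≈0⇒∣ ab≈0))
    ... | inj₁ p∣a = inj₁ (∣⇒≈0 p∣a)
    ... | inj₂ p∣b = inj₂ (∣⇒≈0 p∣b)

  *≉0 : ∀ {a b} → a ≉ + 0 → b ≉ + 0 → a * b ≉ + 0
  *≉0 a≉0 b≉0 ab≈0 with *≈0 ab≈0
  ... | inj₁ a≈0 = a≉0 a≈0
  ... | inj₂ b≈0 = b≉0 b≈0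

  *-cancelˡ : ∀ a {b c} → a ≉ + 0 → a * b ≈ a * c → b ≈ c
  *-cancelˡ a {b} {c} a≉0 ab≈ac with *≈0 {a} {b - c} (subst (_≈ + 0) (identity a b c) (≈⇒-≈0 ab≈ac))
    where
    identity : ∀ a b c → a * b - a * c ≡ a * (b - c)
    identity = solve-∀
  ... | inj₁ a≈0   = contradiction a≈0 a≉0
  ... | inj₂ b-c≈0 = -≈0⇒≈ b-c≈0

  square-roots : ∀ {a b} → a * a ≈ b * b → a ≈ b ⊎ a ≈ - b
  square-roots {a} {b} aa≈bb with *≈0 {a - b} {a - - b} (subst (_≈ + 0) (identity a b) (≈⇒-≈0 aa≈bb))
    where
    identity : ∀ a b → a * a - b * b ≡ (a - b) * (a - - b)
    identity = solve-∀
  ... | inj₁ a-b≈0 = inj₁ (-≈0⇒≈ a-b≈0)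
  ... | inj₂ a+b≈0 = inj₂ (-≈0⇒≈ a+b≈0)

  ^≉0 : ∀ n {a} → a ≉ + 0 → a ^ n ≉ + 0
  ^≉0 zero    a≉0 = 1≉0
  ^≉0 (suc n) a≉0 = *≉0 a≉0 (^≉0 n a≉0)

  ∏≉0 : ∀ n {f} → (∀ i → i ℕ.< n → f i ≉ + 0) → ∏ n f ≉ + 0
  ∏≉0 zero    f≉0 = 1≉0
  ∏≉0 (suc n) f≉0 = *≉0 (f≉0 0 (ℕ.s≤s ℕ.z≤n)) (∏≉0 n (λ i i<n → f≉0 (suc i) (ℕ.s≤s i<n)))

  !≉0 : ∀ n → n ℕ.< p → + (n !) ≉ + 0
  !≉0 n n<p = subst (_≉ + 0) (∏-! n)
    (∏≉0 n (λ i i<n → small≉0 (ℕ.s≤s ℕ.z≤n) (ℕP.≤-<-trans i<n n<p)))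

-- Wilson's theorem, Fermat's theorem and Euler's criterion

module _ {A : Set} where

  Unique-↭ : ∀ {xs ys : List A} → xs ↭ ys → Unique xs → Unique ys
  Unique-↭ = PermutationP.Unique-resp-↭ (setoid A) ∘ ↭⇒↭ₛ

  extract : ∀ {x} {xs : List A} → x ∈ xs → ∃ λ ys → xs ↭ x ∷ ys
  extract {x} x∈xs with ys , zs , refl ← ∈-∃++ x∈xs = ys List.++ zs , shift x ys zs

  extract₂ : ∀ {x y} {xs : List A} → x ∈ xs → y ∈ xs → x ≢ y → ∃ λ ys → xs ↭ x ∷ y ∷ ys
  extract₂ x∈xs y∈xs x≢y with extract x∈xs
  ... | zs , σ with ∈-resp-↭ σ y∈xs
  ...   | here y≡x = contradiction (sym y≡x) x≢y
  ...   | there y∈zs with ys , τ ← extract y∈zs = ys , ↭-trans σ (prep _ τ)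

module Euler (p : ℕ) (prime : Prime p) where
  open PrimeModulus p prime

  private instance
    p≢0 : ℕ.NonZero p
    p≢0 = prime⇒nonZero prime

  opaque
    residue : ∀ a → ∃ λ r → r ℕ.< p × a ≈ + r
    residue a = a ℤDM.%ℕ p , ℤDM.n%ℕd<d a p , (begin
      a                                     ≡⟨ ℤDM.a≡a%ℕn+[a/ℕn]*n a p ⟩
      + (a ℤDM.%ℕ p) + (a ℤDM./ℕ p) * + p   ≈⟨ +-cong (≈-refl {+ (a ℤDM.%ℕ p)}) (*-congˡ (a ℤDM./ℕ p) p≈0) ⟩
      + (a ℤDM.%ℕ p) + (a ℤDM./ℕ p) * + 0   ≡⟨ cong (λ b → + (a ℤDM.%ℕ p) + b) (ℤP.*-zeroʳ (a ℤDM./ℕ p)) ⟩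
      + (a ℤDM.%ℕ p) + + 0                  ≡⟨ ℤP.+-identityʳ _ ⟩
      + (a ℤDM.%ℕ p)                        ∎)
      where open ≈-Reasoning

    inverse : ∀ x → 0 ℕ.< x → x ℕ.< p → ∃ λ b → + x * b ≈ + 1
    inverse x 0<x x<p with coprime-Bézout (prime⇒coprime prime {{ℕ.>-nonZero 0<x}} x<p)
    ... | GCD.Bézout.+- u v eq = - + v , (begin
      + x * - + v                ≡⟨ identity (+ x) (+ v) ⟩
      + 1 - (+ 1 + + v * + x)    ≡⟨ cong (λ w → + 1 - w) (trans (cong (λ w → + 1 + w) (sym (ℤP.pos-* v x))) (trans (cong +_ eq) (ℤP.pos-* u p))) ⟩
      + 1 - + u * + p            ≈⟨ +-cong (≈-refl {+ 1}) (-‿cong (*-congˡ (+ u) p≈0)) ⟩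
      + 1 - + u * + 0            ≡⟨ cong (λ w → + 1 - w) (ℤP.*-zeroʳ (+ u)) ⟩
      + 1                        ∎)
      where
      open ≈-Reasoning
      identity : ∀ x v → x * - v ≡ + 1 - (+ 1 + v * x)
      identity = solve-∀
    ... | GCD.Bézout.-+ u v eq = + v , (begin
      + x * + v            ≡⟨ ℤP.*-comm (+ x) (+ v) ⟩
      + v * + x            ≡⟨ trans (sym (ℤP.pos-* v x)) (trans (cong +_ (sym eq)) (cong (λ w → + 1 + w) (ℤP.pos-* u p))) ⟩
      + 1 + + u * + p      ≈⟨ +-cong (≈-refl {+ 1}) (*-congˡ (+ u) p≈0) ⟩
      + 1 + + u * + 0      ≡⟨ cong (λ w → + 1 + w) (ℤP.*-zeroʳ (+ u)) ⟩
      + 1                  ∎)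
      where open ≈-Reasoning

    -- Supplies the partner a/x of x, again as a number strictly between 0 and p, so that it lies in
    -- the list of units.
    quotient : ∀ {a} x → a ≉ + 0 → 0 ℕ.< x → x ℕ.< p → ∃ λ y → 0 ℕ.< y × y ℕ.< p × + x * + y ≈ a
    quotient {a} x a≉0 0<x x<p with b , xb≈1 ← inverse x 0<x x<p with residue (b * a)
    ... | y , y<p , ba≈y = y , positive y xy≈a , y<p , xy≈a
      where
      open ≈-Reasoning
      xy≈a : + x * + y ≈ a
      xy≈a = begin
        + x * + y     ≈⟨ *-congˡ (+ x) ba≈y ⟨
        + x * (b * a) ≡⟨ ℤP.*-assoc (+ x) b a ⟨
        + x * b * a   ≈⟨ *-congʳ a xb≈1 ⟩
        + 1 * a       ≡⟨ ℤP.*-identityˡ a ⟩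
        a             ∎
      positive : ∀ y → + x * + y ≈ a → 0 ℕ.< y
      positive (suc _) _    = ℕ.s≤s ℕ.z≤n
      positive zero    x0≈a = contradiction (≈-trans (≈-sym x0≈a) (≈-reflexive (ℤP.*-zeroʳ (+ x)))) a≉0

  -- Remove an entry together with its partner, collect one factor a, and recurse. Since partners
  -- are unique modulo p, the shorter list is still closed under taking partners.
  product-of-pairs : ∀ {a} → a ≉ + 0 → ∀ k (xs : List ℕ) → length xs ≡ k ℕ.+ k → Unique xs →
    (∀ {x} → x ∈ xs → x ℕ.< p) →
    (∀ {x} → x ∈ xs → ∃ λ y → y ∈ xs × x ≢ y × + x * + y ≈ a) →
    + product xs ≈ a ^ k
  product-of-pairs         a≉0 zero    []       _   _  _     _       = ≈-refl
  product-of-pairs {a}     a≉0 (suc k) (x ∷ xs) len uq small partner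
    with y , y∈ , x≢y , xy≈a ← partner (here refl)
    with ys , σ ← extract₂ (here refl) y∈ x≢y
    with (x∉ ∷ y∉ ∷ uq-ys) ← Unique-↭ σ uq = begin
      + product (x ∷ xs)       ≡⟨ cong +_ (product-↭ σ) ⟩
      + (x ℕ.* (y ℕ.* product ys))  ≡⟨ cong +_ (ℕP.*-assoc x y _) ⟨
      + (x ℕ.* y ℕ.* product ys)    ≡⟨ trans (ℤP.pos-* (x ℕ.* y) _) (cong (_* + product ys) (ℤP.pos-* x y)) ⟩
      + x * + y * + product ys      ≈⟨ *-cong xy≈a (product-of-pairs a≉0 k ys length-ys uq-ys (small ∘ back) partner′) ⟩
      a * a ^ k                     ∎
    where
    open ≈-Reasoning
    length-ys : length ys ≡ k ℕ.+ k
    length-ys = ℕP.suc-injective (ℕP.suc-injective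
      (trans (sym (↭-length σ)) (trans len (cong suc (ℕP.+-suc k k)))))
    back : ∀ {z} → z ∈ ys → z ∈ x ∷ xs
    back z∈ = ∈-resp-↭ (↭-sym σ) (there (there z∈))
    -- As uv ≡ a is a unit, so is u, and the equation determines the partner of u. Hence no
    -- remaining z can have the removed x or y as its partner.
    same : ∀ u {v w} → u ∈ x ∷ xs → v ∈ x ∷ xs → w ∈ x ∷ xs → + u * + v ≈ a → + w * + u ≈ a → v ≡ w
    same u {v} {w} u∈ v∈ w∈ uv≈a wu≈a = small-injective (small v∈) (small w∈)
      (*-cancelˡ (+ u) u≉0 (≈-trans uv≈a (≈-trans (≈-sym wu≈a) (≈-reflexive (ℤP.*-comm (+ w) (+ u))))))
      where
      u≉0 : + u ≉ + 0
      u≉0 u≈0 = a≉0 (≈-trans (≈-sym uv≈a) (*-congʳ (+ v) u≈0))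
    partner′ : ∀ {z} → z ∈ ys → ∃ λ w → w ∈ ys × z ≢ w × + z * + w ≈ a
    partner′ {z} z∈ with w , w∈ , z≢w , zw≈a ← partner (back z∈) with ∈-resp-↭ σ w∈
    ... | here refl            = contradiction (same x (here refl) y∈ (back z∈) xy≈a zw≈a) (All.lookup y∉ z∈)
    ... | there (here refl)    = contradiction (same y y∈ (here refl) (back z∈) (≈-trans (≈-reflexive (ℤP.*-comm (+ y) (+ x))) xy≈a) zw≈a) (All.lookup x∉ (there z∈))
    ... | there (there w∈ys)   = w , w∈ys , z≢w , zw≈a

  -- Listed downwards so that the product unfolds along the recursion of the factorial.
  units : ℕ → List ℕ
  units n = map suc (downFrom n)

  product-units : ∀ n → product (units n) ≡ n !
  product-units zero    = refl
  product-units (suc n) = cong (suc n ℕ.*_) (product-units n)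

  module _ (n : ℕ) (p≡2n+1 : p ≡ suc (n ℕ.+ n)) where

    private
      us : List ℕ
      us = units (n ℕ.+ n)

      length-us : length us ≡ n ℕ.+ n
      length-us = trans (ListP.length-map suc (downFrom (n ℕ.+ n))) (ListP.length-downFrom (n ℕ.+ n))

      unique-us : Unique us
      unique-us = UniqueP.map⁺ ℕP.suc-injective (UniqueP.downFrom⁺ (n ℕ.+ n))

      ∈us⁺ : ∀ {x} → 0 ℕ.< x → x ℕ.< p → x ∈ us
      ∈us⁺ {suc x} _ x<p = ∈-map⁺ suc (∈-downFrom⁺ (ℕ.s≤s⁻¹ (subst (suc x ℕ.<_) p≡2n+1 x<p)))

      ∈us⁻ : ∀ {x} → x ∈ us → 0 ℕ.< x × x ℕ.< p
      ∈us⁻ x∈ with y , y∈ , refl ← ∈-map⁻ suc x∈ =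
        ℕ.s≤s ℕ.z≤n , subst (suc y ℕ.<_) (sym p≡2n+1) (ℕ.s≤s (∈-downFrom⁻ y∈))

    nonsquare-! : ∀ {a} → a ≉ + 0 → (∀ x → x ℕ.< p → + x * + x ≉ a) → + ((n ℕ.+ n) !) ≈ a ^ n
    nonsquare-! {a} a≉0 nonsquare = subst (λ k → + k ≈ a ^ n) (product-units (n ℕ.+ n))
      (product-of-pairs a≉0 n us length-us unique-us (proj₂ ∘ ∈us⁻) partner)
      where
      partner : ∀ {x} → x ∈ us → ∃ λ y → y ∈ us × x ≢ y × + x * + y ≈ a
      partner {x} x∈ with 0<x , x<p ← ∈us⁻ x∈ with y , 0<y , y<p , xy≈a ← quotient x a≉0 0<x x<p =
        -- An x paired with itself would be a square root of a.
        y , ∈us⁺ 0<y y<p , (λ { refl → nonsquare x x<p xy≈a }) , xy≈a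

    -- Only b and p - b are their own partners. They are taken out first and contribute b · (-b) ≡
    -- -a; the other units form n - 1 pairs.
    square-! : ∀ {a} b → 0 ℕ.< b → b ℕ.< p → + b * + b ≈ a → + ((n ℕ.+ n) !) ≈ - (a ^ n)
    square-! {a} b 0<b b<p bb≈a = go n refl
      where
      b≉0 : + b ≉ + 0
      b≉0 = small≉0 0<b b<p
      a≉0 : a ≉ + 0
      a≉0 a≈0 = *≉0 b≉0 b≉0 (≈-trans bb≈a a≈0)
      c : ℕ
      c = p ∸ b
      c≈-b : + c ≈ - + b
      c≈-b = begin
        + c        ≡⟨ trans (ℤP.m-n≡m⊖n p b) (ℤP.⊖-≥ (ℕP.<⇒≤ b<p)) ⟨
        + p - + b  ≈⟨ +-cong p≈0 (≈-refl { - + b}) ⟩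
        + 0 - + b  ≡⟨ ℤP.+-identityˡ (- + b) ⟩
        - + b      ∎
        where open ≈-Reasoning
      c<p : c ℕ.< p
      c<p = ℕP.∸-monoʳ-< 0<b (ℕP.<⇒≤ b<p)
      0<c : 0 ℕ.< c
      0<c = ℕP.m<n⇒0<n∸m b<p
      b≢c : b ≢ c
      -- Otherwise p = 2b would be even.
      b≢c b≡c = ℕP.even≢odd b n (begin
        2 ℕ.* b           ≡⟨ cong (b ℕ.+_) (ℕP.+-identityʳ b) ⟩
        b ℕ.+ b           ≡⟨ cong (b ℕ.+_) b≡c ⟩
        b ℕ.+ (p ∸ b)     ≡⟨ ℕP.m+[n∸m]≡n (ℕP.<⇒≤ b<p) ⟩
        p                 ≡⟨ p≡2n+1 ⟩
        suc (n ℕ.+ n)     ≡⟨ cong (λ m → suc (n ℕ.+ m)) (ℕP.+-identityʳ n) ⟨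
        suc (2 ℕ.* n)     ∎)
        where open ≡-Reasoning

      roots : ∀ {x} → x ℕ.< p → + x * + x ≈ a → x ≡ b ⊎ x ≡ c
      roots {x} x<p xx≈a with square-roots (≈-trans xx≈a (≈-sym bb≈a))
      ... | inj₁ x≈b  = inj₁ (small-injective x<p b<p x≈b)
      ... | inj₂ x≈-b = inj₂ (small-injective x<p c<p (≈-trans x≈-b (≈-sym c≈-b)))

      cc≈a : + c * + c ≈ a
      cc≈a = ≈-trans (*-cong c≈-b c≈-b) (≈-trans (≈-reflexive (identity (+ b))) bb≈a)
        where
        identity : ∀ b → - b * - b ≡ b * b
        identity = solve-∀

      -- The exponent is separated from n so that it can be split into cases while the list of units
      -- keeps its length n + n. Exponent 0 would mean p = 1.
      go : ∀ m → m ≡ n → + ((n ℕ.+ n) !) ≈ - (a ^ m)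
      go zero    refl = contradiction (subst Prime p≡2n+1 prime) ¬prime[1]
      go (suc k) k+1≡n
        with ys , σ ← extract₂ (∈us⁺ 0<b b<p) (∈us⁺ 0<c c<p) b≢c
        with (b∉ ∷ c∉ ∷ uq-ys) ← Unique-↭ σ unique-us = begin
          + ((n ℕ.+ n) !)              ≡⟨ cong +_ (trans (sym (product-units (n ℕ.+ n))) (product-↭ σ)) ⟩
          + (b ℕ.* (c ℕ.* product ys)) ≡⟨ trans (ℤP.pos-* b _) (cong (+ b *_) (ℤP.pos-* c _)) ⟩
          + b * (+ c * + product ys)   ≈⟨ *-congˡ (+ b) (*-cong c≈-b (product-of-pairs a≉0 k ys length-ys uq-ys (proj₂ ∘ ∈us⁻ ∘ back) partner)) ⟩
          + b * (- + b * a ^ k)        ≡⟨ identity (+ b) (a ^ k) ⟩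
          - (+ b * + b * a ^ k)        ≈⟨ -‿cong (*-congʳ (a ^ k) bb≈a) ⟩
          - (a * a ^ k)                ∎
        where
        open ≈-Reasoning
        identity : ∀ b d → b * (- b * d) ≡ - (b * b * d)
        identity = solve-∀
        length-ys : length ys ≡ k ℕ.+ k
        length-ys = ℕP.suc-injective (ℕP.suc-injective (trans (sym (↭-length σ)) (trans length-us
          (trans (cong (λ m → m ℕ.+ m) (sym k+1≡n)) (cong suc (ℕP.+-suc k k))))))
        back : ∀ {z} → z ∈ ys → z ∈ us
        back z∈ = ∈-resp-↭ (↭-sym σ) (there (there z∈))
        same : ∀ u {z} → u ℕ.< p → + u * + u ≈ a → z ∈ ys → + z * + u ≈ a → u ≡ z
        same u {z} u<p uu≈a z∈ zu≈a = small-injective u<p (proj₂ (∈us⁻ (back z∈)))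
          (*-cancelˡ (+ u) (λ u≈0 → a≉0 (≈-trans (≈-sym uu≈a) (*-congʳ (+ u) u≈0)))
            (≈-trans uu≈a (≈-trans (≈-sym zu≈a) (≈-reflexive (ℤP.*-comm (+ z) (+ u))))))
        partner : ∀ {z} → z ∈ ys → ∃ λ w → w ∈ ys × z ≢ w × + z * + w ≈ a
        partner {z} z∈
          with 0<z , z<p ← ∈us⁻ (back z∈)
          with w , 0<w , w<p , zw≈a ← quotient z a≉0 0<z z<p
          with ∈-resp-↭ σ (∈us⁺ 0<w w<p)
        ... | here refl         = contradiction (same w w<p bb≈a z∈ zw≈a) (All.lookup b∉ (there z∈))
        ... | there (here refl) = contradiction (same w w<p cc≈a z∈ zw≈a) (All.lookup c∉ z∈)
        ... | there (there w∈)  = w , w∈ , z≢w , zw≈a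
          where
          z≢w : z ≢ w
          z≢w refl with roots z<p zw≈a
          ... | inj₁ refl = All.lookup b∉ (there z∈) refl
          ... | inj₂ refl = All.lookup c∉ z∈ refl

    wilson : + ((n ℕ.+ n) !) ≈ - + 1
    wilson = ≈-trans (square-! 1 (ℕ.s≤s ℕ.z≤n) 1<p ≈-refl) (≈-reflexive (cong -_ (ℤP.^-zeroˡ n)))
      where
      1<p : 1 ℕ.< p
      1<p = ℕP.≤∧≢⇒< (ℕ.>-nonZero⁻¹ p) (λ { refl → ¬prime[1] prime })

    euler-square : ∀ {a} b → + b * + b ≈ a → b ℕ.< p → a ≉ + 0 → a ^ n ≈ + 1
    euler-square {a} zero bb≈a b<p a≉0 = contradiction (≈-sym bb≈a) a≉0
    euler-square {a} (suc b) bb≈a b<p a≉0 = begin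
      a ^ n          ≡⟨ ℤP.neg-involutive (a ^ n) ⟨
      - - (a ^ n)    ≈⟨ -‿cong (≈-trans (≈-sym (square-! (suc b) (ℕ.s≤s ℕ.z≤n) b<p bb≈a)) wilson) ⟩
      + 1            ∎
      where open ≈-Reasoning

    -- Here a^n · a^n = (a²)^n, and a² is the square of the residue of a, so the square case of
    -- Euler's criterion suffices.
    fermat : ∀ {a} → a ≉ + 0 → a ^ n * a ^ n ≈ + 1
    fermat {a} a≉0 with r , r<p , a≈r ← residue a = begin
      a ^ n * a ^ n  ≡⟨ ^-distribʳ-* n a a ⟨
      (a * a) ^ n    ≈⟨ euler-square r (*-cong (≈-sym a≈r) (≈-sym a≈r)) r<p (*≉0 a≉0 a≉0) ⟩
      + 1            ∎
      where
      open ≈-Reasoning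

    legendre-euler : ∀ {a} → a ≉ + 0 → legendre a p ≈ a ^ n
    legendre-euler {a} a≉0 with p ℕD.∣? ∣ a ∣
    ... | yes p∣a = contradiction (∣⇒≈0 p∣a) a≉0
    ... | no  _   with any? (λ x → p ℕD.∣? ∣ + x * + x - a ∣) (upTo p)
    ...   | yes x∈ with x , x∈upTo , p∣ ← Membership.find x∈ =
              ≈-sym (euler-square x (≡[mod]⇒≈ p∣) (∈-upTo⁻ x∈upTo) a≉0)
    -- With no root below p, pairing evaluates (p-1)! as a^n, whereas Wilson's theorem evaluates it
    -- as -1.
    ...   | no  ¬x∈ = ≈-trans (≈-sym wilson) (nonsquare-! a≉0
              (λ x x<p xx≈a → ¬x∈ (Membership.lose (∈-upTo⁺ x<p) (≈⇒≡[mod] xx≈a))))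

-- The linear factors of the form

sq : ℤ → ℤ
sq x = x * x

sq-* : ∀ a b → sq (a * b) ≡ sq a * sq b
sq-* a b = *-interchange a b a b

∏∏ : ℕ → (ℕ → ℕ → ℤ) → ℤ
∏∏ n f = ∏ n (λ i → ∏ n (f i))

∏∏-distrib-* : ∀ n f g → ∏∏ n (λ i j → f i j * g i j) ≡ ∏∏ n f * ∏∏ n g
∏∏-distrib-* n f g = trans (∏-cong-≡ n (λ i → ∏-distrib-* n (f i) (g i))) (∏-distrib-* n _ _)

even+ odd : ℕ → ℕ
even+ i = suc (suc (i ℕ.+ i))
odd   q = suc (q ℕ.+ q)

module Rows (p : ℕ) (prime : Prime p) (n : ℕ) (p≡2n+1 : p ≡ suc (n ℕ.+ n))
            (3≉0 : Congruence._≉_ p (+ 3) (+ 0)) where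
  open PrimeModulus p prime
  open Euler p prime

  ∏∏-cong : ∀ {f g} → (∀ i j → i ℕ.< n → j ℕ.< n → f i j ≈ g i j) → ∏∏ n f ≈ ∏∏ n g
  ∏∏-cong f≈g = ∏-cong n (λ i i<n → ∏-cong n (λ j j<n → f≈g i j i<n j<n))

  sq-cong : ∀ {a b} → a ≈ b → sq a ≈ sq b
  sq-cong a≈b = *-cong a≈b a≈b

  -- Branches on the same Boolean test as `factor`, so that `N` applied to the form is `factor` by
  -- definition.
  ifzero : ℤ → ℤ → ℤ → ℤ
  ifzero x a b = if does (p ℕD.∣? ∣ x ∣) then a else b

  ifzero-yes : ∀ {x} a b → x ≈ + 0 → ifzero x a b ≡ a
  ifzero-yes {x} a b x≈0 with p ℕD.∣? ∣ x ∣
  ... | yes _   = refl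
  ... | no  p∤x = contradiction (≈0⇒∣ x≈0) p∤x

  ifzero-no : ∀ {x} a b → x ≉ + 0 → ifzero x a b ≡ b
  ifzero-no {x} a b x≉0 with p ℕD.∣? ∣ x ∣
  ... | yes p∣x = contradiction (∣⇒≈0 p∣x) x≉0
  ... | no  _   = refl

  zero? : ∀ x → Dec (x ≈ + 0)
  zero? x with p ℕD.∣? ∣ x ∣
  ... | yes p∣x = yes (∣⇒≈0 p∣x)
  ... | no  p∤x = no (p∤x ∘ ≈0⇒∣)

  N M : ℤ → ℤ
  N x = ifzero x (+ 1) x
  M x = sq (N x)

  N-zero : ∀ {x} → x ≈ + 0 → N x ≡ + 1
  N-zero {x} = ifzero-yes (+ 1) x

  N-unit : ∀ {x} → x ≉ + 0 → N x ≡ x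
  N-unit {x} = ifzero-no (+ 1) x

  N-cong : ∀ {x y} → x ≈ y → N x ≈ N y
  N-cong {x} {y} x≈y with zero? x
  ... | yes x≈0 = ≈-reflexive (trans (N-zero x≈0) (sym (N-zero (≈-trans (≈-sym x≈y) x≈0))))
  ... | no  x≉0 = subst₂ _≈_ (sym (N-unit x≉0)) (sym (N-unit (x≉0 ∘ ≈-trans x≈y))) x≈y

  M-cong : ∀ {x y} → x ≈ y → M x ≈ M y
  M-cong = sq-cong ∘ N-cong

  M-unit : ∀ {x} → x ≉ + 0 → M x ≡ sq x
  M-unit = cong sq ∘ N-unit

  neg≈0 : ∀ {x} → - x ≈ + 0 → x ≈ + 0
  neg≈0 {x} = subst (_≈ + 0) (ℤP.neg-involutive x) ∘ -‿cong

  M-neg : ∀ x → M (- x) ≡ M x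
  M-neg x with zero? x
  ... | yes x≈0 = cong sq (trans (N-zero (-‿cong x≈0)) (sym (N-zero x≈0)))
  ... | no  x≉0 = trans (M-unit (x≉0 ∘ neg≈0)) (trans (identity x) (sym (M-unit x≉0)))
    where
    identity : ∀ x → - x * - x ≡ x * x
    identity = solve-∀

  linear : ℤ → ℤ → ℤ → ℤ
  linear δ i j = + 2 * i + δ * j

  -- Correction for the zeros of u: where u(i,j) vanishes, the form is omitted from T, but the unit
  -- u(j,i) still occurs in the product of the linear factors.
  K : ℤ → ℤ → ℤ → ℤ
  K δ i j = ifzero (linear δ i j) (- (+ 3 * i)) (+ 1)

  entry : ℤ → (ℤ → ℤ → ℤ → ℤ) → ℕ → ℕ → ℤ
  entry δ f i j = f δ (+ suc i) (+ suc j)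

  𝒦 ℳ : ℤ → ℤ
  𝒦 δ = ∏∏ n (entry δ K)
  ℳ δ = ∏∏ n (entry δ (λ ε i j → M (linear ε i j)))

  ≤2n⇒<p : ∀ {x} → x ℕ.≤ n ℕ.+ n → x ℕ.< p
  ≤2n⇒<p x≤2n = subst (_ ℕ.<_) (sym p≡2n+1) (ℕ.s≤s x≤2n)

  ≤n⇒<p : ∀ {x} → x ℕ.≤ n → x ℕ.< p
  ≤n⇒<p x≤n = ≤2n⇒<p (ℕP.≤-trans x≤n (ℕP.m≤m+n n n))

  ≤2n⇒≉0 : ∀ {x} → 0 ℕ.< x → x ℕ.≤ n ℕ.+ n → + x ≉ + 0
  ≤2n⇒≉0 0<x x≤2n = small≉0 0<x (≤2n⇒<p x≤2n)

  suc≉0 : ∀ {i} → i ℕ.< n → + suc i ≉ + 0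
  suc≉0 i<n = small≉0 (ℕ.s≤s ℕ.z≤n) (≤n⇒<p i<n)

  module _ {δ : ℤ} (δδ≡1 : δ * δ ≡ + 1) where

    private
      -- The ring solver cannot use δ² = 1. It is given an identity with an explicit multiple c of
      -- δ² - 1, which is then discarded; this treats both signs of δ at once.
      modulo-δδ : ∀ {x y} c → x ≡ y + (δ * δ - + 1) * c → x ≡ y
      modulo-δδ {x} {y} c eq = begin
        x                          ≡⟨ eq ⟩
        y + (δ * δ - + 1) * c      ≡⟨ cong (λ d → y + (d - + 1) * c) δδ≡1 ⟩
        y + + 0 * c                ≡⟨ cong (λ d → y + d) (ℤP.*-zeroˡ c) ⟩
        y + + 0                    ≡⟨ ℤP.+-identityʳ y ⟩
        y                          ∎
        where open ≡-Reasoning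

      quadratic : ℤ → ℤ → ℤ
      quadratic i j = + 2 * i * i + + 5 * δ * i * j + + 2 * j * j

      quadratic≡ : ∀ i j → quadratic i j ≡ δ * (linear δ i j * linear δ j i)
      quadratic≡ i j = sym (modulo-δδ (+ 2 * i * i + + 2 * j * j + δ * i * j) (identity δ i j))
        where
        identity : ∀ δ i j → δ * ((+ 2 * i + δ * j) * (+ 2 * j + δ * i)) ≡
          (+ 2 * i * i + + 5 * δ * i * j + + 2 * j * j) + (δ * δ - + 1) * (+ 2 * i * i + + 2 * j * j + δ * i * j)
        identity = solve-∀

      conjugate : ∀ i j → linear δ i j ≈ + 0 → δ * linear δ j i ≈ - (+ 3 * i)
      conjugate i j u≈0 = begin
        δ * linear δ j i                  ≡⟨ modulo-δδ i (identity δ i j) ⟩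
        + 2 * linear δ i j - + 3 * i      ≈⟨ +-cong (*-congˡ (+ 2) u≈0) ≈-refl ⟩
        + 2 * + 0 - + 3 * i               ≡⟨ ℤP.+-identityˡ _ ⟩
        - (+ 3 * i)                       ∎
        where
        open ≈-Reasoning
        identity : ∀ δ i j → δ * (+ 2 * j + δ * i) ≡ (+ 2 * (+ 2 * i + δ * j) - + 3 * i) + (δ * δ - + 1) * i
        identity = solve-∀

      δ≉0 : δ ≉ + 0
      δ≉0 δ≈0 = 1≉0 (≈-trans (≈-reflexive (sym δδ≡1)) (*-congʳ δ δ≈0))

      quadratic-zero : ∀ i j → linear δ i j * linear δ j i ≈ + 0 → quadratic i j ≈ + 0
      quadratic-zero i j uu′≈0 = ≈-trans (≈-reflexive (quadratic≡ i j))
        (≈-trans (*-congˡ δ uu′≈0) (≈-reflexive (ℤP.*-zeroʳ δ)))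

    -- If exactly one of the linear factors vanishes, the form contributes 1, and `conjugate`
    -- identifies δ times the surviving factor with the value of `K`. Both cannot vanish, as 3i is a
    -- unit.
    factor-linear : ∀ i j → i ≉ + 0 →
      N (quadratic i j) * (K δ i j * K δ j i) ≈ δ * (N (linear δ i j) * N (linear δ j i))
    factor-linear i j i≉0 with zero? (linear δ i j) | zero? (linear δ j i)
    ... | yes u≈0 | yes u′≈0 = contradiction 3i≈0 (*≉0 3≉0 i≉0)
      where
      open ≈-Reasoning
      3i≈0 : + 3 * i ≈ + 0
      3i≈0 = neg≈0 (begin
        - (+ 3 * i)        ≈⟨ conjugate i j u≈0 ⟨
        δ * linear δ j i   ≈⟨ *-congˡ δ u′≈0 ⟩
        δ * + 0            ≡⟨ ℤP.*-zeroʳ δ ⟩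
        + 0                ∎)
    ... | yes u≈0 | no u′≉0 = begin
      N (quadratic i j) * (K δ i j * K δ j i)
        ≡⟨ cong₂ _*_ (N-zero (quadratic-zero i j (*-congʳ (linear δ j i) u≈0)))
             (cong₂ _*_ (ifzero-yes _ _ u≈0) (ifzero-no _ _ u′≉0)) ⟩
      + 1 * (- (+ 3 * i) * + 1)                  ≡⟨ trans (ℤP.*-identityˡ _) (ℤP.*-identityʳ _) ⟩
      - (+ 3 * i)                                ≈⟨ conjugate i j u≈0 ⟨
      δ * linear δ j i                           ≡⟨ cong (δ *_) (ℤP.*-identityˡ _) ⟨
      δ * (+ 1 * linear δ j i)                   ≡⟨ cong (δ *_) (cong₂ _*_ (N-zero u≈0) (N-unit u′≉0)) ⟨
      δ * (N (linear δ i j) * N (linear δ j i))  ∎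
      where open ≈-Reasoning
    ... | no u≉0 | yes u′≈0 = begin
      N (quadratic i j) * (K δ i j * K δ j i)
        ≡⟨ cong₂ _*_ (N-zero (quadratic-zero i j (≈-trans (*-congˡ (linear δ i j) u′≈0) (≈-reflexive (ℤP.*-zeroʳ (linear δ i j))))))
             (cong₂ _*_ (ifzero-no _ _ u≉0) (ifzero-yes _ _ u′≈0)) ⟩
      + 1 * (+ 1 * - (+ 3 * j))                  ≡⟨ trans (ℤP.*-identityˡ _) (ℤP.*-identityˡ _) ⟩
      - (+ 3 * j)                                ≈⟨ conjugate j i u′≈0 ⟨
      δ * linear δ i j                           ≡⟨ cong (δ *_) (ℤP.*-identityʳ _) ⟨
      δ * (linear δ i j * + 1)                   ≡⟨ cong (δ *_) (cong₂ _*_ (N-unit u≉0) (N-zero u′≈0)) ⟨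
      δ * (N (linear δ i j) * N (linear δ j i))  ∎
      where open ≈-Reasoning
    ... | no u≉0 | no u′≉0 = begin
      N (quadratic i j) * (K δ i j * K δ j i)
        ≡⟨ cong₂ _*_ (N-unit quadratic≉0) (cong₂ _*_ (ifzero-no _ _ u≉0) (ifzero-no _ _ u′≉0)) ⟩
      quadratic i j * + 1                        ≡⟨ ℤP.*-identityʳ _ ⟩
      quadratic i j                              ≡⟨ quadratic≡ i j ⟩
      δ * (linear δ i j * linear δ j i)          ≡⟨ cong (δ *_) (cong₂ _*_ (N-unit u≉0) (N-unit u′≉0)) ⟨
      δ * (N (linear δ i j) * N (linear δ j i))  ∎
      where
      open ≈-Reasoning
      quadratic≉0 : quadratic i j ≉ + 0
      quadratic≉0 = subst (_≉ + 0) (sym (quadratic≡ i j)) (*≉0 δ≉0 (*≉0 u≉0 u′≉0))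

    -- Transposing the square of indices turns the product of the u(j,i) into that of the u(i,j),
    -- and likewise for `K`; this is how the squares arise.
    T-linear : T p δ * sq (𝒦 δ) ≈ (δ ^ n) ^ n * ℳ δ
    T-linear = begin
      T p δ * sq (𝒦 δ)
        ≡⟨ cong₂ _*_ (T-∏ p δ n half) (cong (𝒦 δ *_) (∏-swap n n (entry δ K))) ⟩
      ∏∏ n F * (𝒦 δ * ∏∏ n (λ i j → entry δ K j i))
        ≡⟨ trans (∏∏-distrib-* n F _) (cong (∏∏ n F *_) (∏∏-distrib-* n (entry δ K) _)) ⟨
      ∏∏ n (λ i j → F i j * (entry δ K i j * entry δ K j i))
        -- `F i j` unfolds to `N` of the form at (i+1, j+1), which is what `factor-linear` speaks
        -- of.
        ≈⟨ ∏∏-cong (λ i j i<n _ → factor-linear (+ suc i) (+ suc j) (suc≉0 i<n)) ⟩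
      ∏∏ n (λ i j → δ * (U i j * U j i))
        ≡⟨ trans (∏∏-distrib-* n (λ _ _ → δ) _) (cong₂ _*_ δ^nn (∏∏-distrib-* n U _)) ⟩
      (δ ^ n) ^ n * (∏∏ n U * ∏∏ n (λ i j → U j i))
        ≡⟨ cong (λ z → (δ ^ n) ^ n * (∏∏ n U * z)) (∏-swap n n U) ⟨
      (δ ^ n) ^ n * (∏∏ n U * ∏∏ n U)
        ≡⟨ cong ((δ ^ n) ^ n *_) (∏∏-distrib-* n U U) ⟨
      (δ ^ n) ^ n * ℳ δ ∎
      where
      open ≈-Reasoning
      F U : ℕ → ℕ → ℤ
      F i j = factor p δ (suc i) (suc j)
      U = entry δ (λ ε i j → N (linear ε i j))
      half : (p ∸ 1) / 2 ≡ n
      half = trans (cong (λ q → (q ∸ 1) / 2) p≡2n+1) (trans (cong (_/ 2) n+n≡n*2) (m*n/n≡m n 2))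
        where
        n+n≡n*2 : n ℕ.+ n ≡ n ℕ.* 2
        n+n≡n*2 = trans (cong (n ℕ.+_) (sym (ℕP.+-identityʳ n))) (ℕP.*-comm 2 n)
      δ^nn : ∏∏ n (λ _ _ → δ) ≡ (δ ^ n) ^ n
      δ^nn = trans (∏-cong-≡ n (λ _ → ∏-const n δ)) (∏-const n (δ ^ n))

-- Squared rows in terms of factorials

sq-sign : ∀ k → sq ((- + 1) ^ k) ≡ + 1
sq-sign zero    = refl
sq-sign (suc k) = trans (sq-* (- + 1) ((- + 1) ^ k)) (trans (ℤP.*-identityˡ _) (sq-sign k))

sq-neg : ∀ x → sq (- x) ≡ sq x
sq-neg = identity
  where
  identity : ∀ x → - x * - x ≡ x * x
  identity = solve-∀

∏-sq : ∀ n f → ∏ n (sq ∘ f) ≡ sq (∏ n f)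
∏-sq n f = ∏-distrib-* n f f

rising-factorial : ∀ k s → ∏ k (λ j → + suc j + + s) * + (s !) ≡ + ((k ℕ.+ s) !)
rising-factorial zero    s = ℤP.*-identityˡ _
rising-factorial (suc k) s = begin
  ∏ (suc k) g * + (s !)            ≡⟨ cong (_* + (s !)) (∏-last k g) ⟩
  ∏ k g * g k * + (s !)            ≡⟨ rearrange (∏ k g) (g k) (+ (s !)) ⟩
  g k * (∏ k g * + (s !))          ≡⟨ cong (g k *_) (rising-factorial k s) ⟩
  g k * + ((k ℕ.+ s) !)            ≡⟨ suc-! (k ℕ.+ s) ⟨
  + ((suc k ℕ.+ s) !)              ∎
  where
  open ≡-Reasoning
  g : ℕ → ℤ
  g j = + suc j + + s
  rearrange : ∀ a b c → a * b * c ≡ b * (a * c)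
  rearrange = solve-∀

module RowProducts (p : ℕ) (prime : Prime p) (n : ℕ) (p≡2n+1 : p ≡ suc (n ℕ.+ n))
                   (3≉0 : Congruence._≉_ p (+ 3) (+ 0)) where
  open PrimeModulus p prime
  open Euler p prime
  open Rows p prime n p≡2n+1 3≉0

  complement : ∀ a b → a ℕ.+ b ≡ p → + a ≈ - + b
  complement a b a+b≡p = -≈0⇒≈ (begin
    + a - - + b   ≡⟨ cong (λ c → + a + c) (ℤP.neg-involutive (+ b)) ⟩
    + (a ℕ.+ b)   ≡⟨ cong +_ a+b≡p ⟩
    + p           ≈⟨ p≈0 ⟩
    + 0           ∎)
    where open ≈-Reasoning

  -- Moving one factor from one factorial to the other costs a sign, since (a+1) + (b+1) = p. The
  -- start a = 0 is Wilson's theorem.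
  half-wilson : ∀ a b → a ℕ.+ b ≡ n ℕ.+ n → + (a !) * + (b !) ≈ (- + 1) ^ suc a
  half-wilson zero    b refl   = ≈-trans (≈-reflexive (ℤP.*-identityˡ _)) (wilson n p≡2n+1)
  half-wilson (suc a) b a+b≡2n = begin
    + (suc a !) * + (b !)          ≡⟨ cong (_* + (b !)) (suc-! a) ⟩
    + suc a * + (a !) * + (b !)    ≈⟨ *-congʳ (+ (b !)) (*-congʳ (+ (a !)) (complement (suc a) (suc b)
                                        (trans (ℕP.+-suc (suc a) b) (trans (cong suc a+b≡2n) (sym p≡2n+1))))) ⟩
    - + suc b * + (a !) * + (b !)  ≡⟨ rearrange (+ suc b) (+ (a !)) (+ (b !)) ⟩
    - (+ (a !) * (+ suc b * + (b !)))  ≡⟨ cong (λ c → - (+ (a !) * c)) (suc-! b) ⟨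
    - (+ (a !) * + (suc b !))      ≈⟨ -‿cong (half-wilson a (suc b) (trans (ℕP.+-suc a b) a+b≡2n)) ⟩
    - ((- + 1) ^ suc a)            ≡⟨ ℤP.-1*i≡-i _ ⟨
    (- + 1) ^ suc (suc a)          ∎
    where
    open ≈-Reasoning
    rearrange : ∀ b c d → - b * c * d ≡ - (c * (b * d))
    rearrange = solve-∀

  sq-half-! : sq (+ (n !)) ≈ (- + 1) ^ suc n
  sq-half-! = half-wilson n n refl

  -- For s ≤ n, `E s` is n! divided by the binomial coefficient of n over s. `P s` and `Q s` are the
  -- squared rows for the residues s and -s; in `P s` nothing vanishes, because j + s ≤ 2n < p,
  -- while in `Q s` the entry at j = s counts as 1.
  E P Q : ℕ → ℤ
  E s = + (s !) * + ((n ∸ s) !)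
  P s = ∏ n (λ j → M (+ suc j + + s))
  Q s = ∏ n (λ j → M (+ suc j - + s))

  E≉0 : ∀ {s} → s ℕ.≤ n → E s ≉ + 0
  E≉0 {s} s≤n = *≉0 (!≉0 s (≤n⇒<p s≤n)) (!≉0 (n ∸ s) (≤n⇒<p (ℕP.m∸n≤m n s)))

  -- Multiplying (n+s)!/s! by E(s) leaves (n+s)! (n-s)!, which is ±1 by `half-wilson`.
  P-E : ∀ {s} → s ℕ.≤ n → P s * sq (E s) ≈ + 1
  P-E {s} s≤n = begin
    P s * sq (E s)                        ≈⟨ *-congʳ (sq (E s)) (∏-cong n (λ j j<n → ≈-reflexive (M-unit (unit j<n)))) ⟩
    ∏ n (sq ∘ g) * sq (E s)               ≡⟨ cong (_* sq (E s)) (∏-sq n g) ⟩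
    sq (∏ n g) * sq (E s)                 ≡⟨ sq-* (∏ n g) (E s) ⟨
    sq (∏ n g * (+ (s !) * + ((n ∸ s) !)))  ≡⟨ cong sq (ℤP.*-assoc (∏ n g) (+ (s !)) (+ ((n ∸ s) !))) ⟨
    sq (∏ n g * + (s !) * + ((n ∸ s) !))  ≡⟨ cong (λ c → sq (c * + ((n ∸ s) !))) (rising-factorial n s) ⟩
    sq (+ ((n ℕ.+ s) !) * + ((n ∸ s) !))  ≈⟨ sq-cong (half-wilson (n ℕ.+ s) (n ∸ s) total) ⟩
    sq ((- + 1) ^ suc (n ℕ.+ s))          ≡⟨ sq-sign (suc (n ℕ.+ s)) ⟩
    + 1                                   ∎
    where
    open ≈-Reasoning
    g : ℕ → ℤ
    g j = + suc j + + s
    unit : ∀ {j} → j ℕ.< n → g j ≉ + 0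
    unit j<n = ≤2n⇒≉0 (ℕ.s≤s ℕ.z≤n) (ℕP.+-mono-≤ j<n s≤n)
    total : n ℕ.+ s ℕ.+ (n ∸ s) ≡ n ℕ.+ n
    total = trans (ℕP.+-assoc n s (n ∸ s)) (cong (n ℕ.+_) (ℕP.m+[n∸m]≡n s≤n))

  -- Cut the row at s = q + 1: the values below give q! up to sign, the zero at s gives 1, and those
  -- above give (n-s)!. The extra factor s² completes q! to s!.
  Q-E : ∀ {q} → q ℕ.< n → Q (suc q) * sq (+ suc q) ≈ sq (E (suc q))
  Q-E {q} q<n = begin
    Q (suc q) * sq (+ suc q)
      ≡⟨ cong (λ k → ∏ k g * sq (+ suc q)) n≡ ⟩
    ∏ (q ℕ.+ suc r) g * sq (+ suc q)
      ≡⟨ cong (_* sq (+ suc q)) (∏-+ q (suc r) g) ⟩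
    ∏ q g * (g (q ℕ.+ 0) * ∏ r (λ i → g (q ℕ.+ suc i))) * sq (+ suc q)
      ≈⟨ *-congʳ (sq (+ suc q)) (*-cong below (*-cong (≈-reflexive middle) above)) ⟩
    sq (+ (q !)) * (+ 1 * sq (+ (r !))) * sq (+ suc q)
      ≡⟨ rearrange (+ (q !)) (+ (r !)) (+ suc q) ⟩
    sq (+ suc q * + (q !) * + (r !))
      ≡⟨ cong (λ c → sq (c * + (r !))) (suc-! q) ⟨
    sq (E (suc q)) ∎
    where
    open ≈-Reasoning
    r : ℕ
    r = n ∸ suc q
    n≡ : n ≡ q ℕ.+ suc r
    n≡ = trans (sym (ℕP.m+[n∸m]≡n q<n)) (sym (ℕP.+-suc q r))
    g : ℕ → ℤ
    g j = M (+ suc j - + suc q)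
    rearrange : ∀ a b c → a * a * (+ 1 * (b * b)) * (c * c) ≡ (c * a * b) * (c * a * b)
    rearrange = solve-∀
    sq-suc : ∀ {i} → i ℕ.< n → M (+ suc i) ≡ sq (+ suc i)
    sq-suc i<n = M-unit (≤2n⇒≉0 (ℕ.s≤s ℕ.z≤n) (ℕP.≤-trans i<n (ℕP.m≤m+n n n)))
    below : ∏ q g ≈ sq (+ (q !))
    below = begin
      ∏ q g                      ≡⟨ ∏-reverse q g (M ∘ +_ ∘ suc) (λ i j i+j → trans (cong M (shifted i j i+j)) (M-neg (+ suc j))) ⟩
      ∏ q (M ∘ +_ ∘ suc)         ≈⟨ ∏-cong q (λ i i<q → ≈-reflexive (sq-suc (ℕP.<-trans i<q q<n))) ⟩
      ∏ q (sq ∘ +_ ∘ suc)        ≡⟨ ∏-sq q (+_ ∘ suc) ⟩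
      sq (∏ q (+_ ∘ suc))        ≡⟨ cong sq (∏-! q) ⟩
      sq (+ (q !))               ∎
      where
      cancel : ∀ a b → a - (a + b) ≡ - b
      cancel = solve-∀
      shifted : ∀ i j → suc (i ℕ.+ j) ≡ q → + suc i - + suc q ≡ - + suc j
      shifted i j refl = trans (cong (λ k → + suc i - + k) (sym (ℕP.+-suc (suc i) j))) (cancel (+ suc i) (+ suc j))
    middle : g (q ℕ.+ 0) ≡ + 1
    middle = cong sq (N-zero (≈-reflexive (trans (cong (λ k → + suc k - + suc q) (ℕP.+-identityʳ q)) (ℤP.+-inverseʳ (+ suc q)))))
    above : ∏ r (λ i → g (q ℕ.+ suc i)) ≈ sq (+ (r !))
    above = begin
      ∏ r (λ i → g (q ℕ.+ suc i))  ≡⟨ ∏-cong-≡ r (λ i → cong M (cancel (+ suc q) (+ suc i))) ⟩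
      ∏ r (M ∘ +_ ∘ suc)         ≈⟨ ∏-cong r (λ i i<r → ≈-reflexive (sq-suc (ℕP.<-≤-trans i<r (ℕP.m∸n≤m n (suc q))))) ⟩
      ∏ r (sq ∘ +_ ∘ suc)        ≡⟨ ∏-sq r (+_ ∘ suc) ⟩
      sq (∏ r (+_ ∘ suc))        ≡⟨ cong sq (∏-! r) ⟩
      sq (+ (r !))               ∎
      where
      cancel : ∀ a b → (a + b) - a ≡ b
      cancel = solve-∀

-- Even and odd multipliers

private
  split₁ : ∀ t a b c → t * ((a * b * c) * (a * b * c)) ≡ t * ((a * a) * ((b * b) * (c * c)))
  split₁ = solve-∀

  split₂ : ∀ t a k c → t * (((a * k) * (a * k)) * c) ≡ t * (k * k) * ((a * a) * c)
  split₂ = solve-∀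

  split₃ : ∀ s w a c → s * w * (a * c) ≡ s * (a * (w * c))
  split₃ = solve-∀

-- The inequalities force `m` and `m′` to be n/2 rounded down and up, that is, the numbers of even
-- and of odd integers from 1 to n.
module Parity (p : ℕ) (prime : Prime p) (n : ℕ) (p≡2n+1 : p ≡ suc (n ℕ.+ n))
              (3≉0 : Congruence._≉_ p (+ 3) (+ 0))
              (m m′ : ℕ) (n≡m+m′ : n ≡ m ℕ.+ m′) (m≤m′ : m ℕ.≤ m′) (m′≤m+1 : m′ ℕ.≤ suc m) where
  open PrimeModulus p prime
  open Rows p prime n p≡2n+1 3≉0
  open RowProducts p prime n p≡2n+1 3≉0

  even+≤n : ∀ {i} → i ℕ.< m → even+ i ℕ.≤ n
  even+≤n {i} i<m = subst₂ ℕ._≤_ (cong suc (ℕP.+-suc i i)) (sym n≡m+m′) (ℕP.+-mono-≤ i<m (ℕP.≤-trans i<m m≤m′))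

  odd≤n : ∀ {q} → q ℕ.< m′ → odd q ℕ.≤ n
  odd≤n {q} q<m′ = subst (odd q ℕ.≤_) (trans (ℕP.+-comm m′ m) (sym n≡m+m′))
    (ℕP.+-mono-≤ q<m′ (ℕ.s≤s⁻¹ (ℕP.≤-trans q<m′ m′≤m+1)))

  -- For i ≤ m the residue of 2i is even and at most n; the remaining 2i are p minus the odd numbers up to n.
  parity-split : ∀ {f a b} → (∀ i → i ℕ.< m → f i ≈ a i) →
    (∀ i q → i ℕ.+ suc q ≡ n → q ℕ.< m′ → f i ≈ b q) → ∏ n f ≈ ∏ m a * ∏ m′ b
  parity-split {f} {a} {b} f≈a f≈b = begin
    ∏ n f                            ≡⟨ cong (λ k → ∏ k f) n≡m+m′ ⟩
    ∏ (m ℕ.+ m′) f                   ≡⟨ ∏-+ m m′ f ⟩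
    ∏ m f * ∏ m′ (λ i → f (m ℕ.+ i)) ≡⟨ cong (∏ m f *_) (∏-reverse m′ (λ i → f (m ℕ.+ i)) (λ q → f (m ℕ.+ (m′ ∸ suc q)))
                                          (λ i q eq → cong (λ k → f (m ℕ.+ k)) (back i q eq))) ⟩
    ∏ m f * ∏ m′ (λ q → f (m ℕ.+ (m′ ∸ suc q)))
      ≈⟨ *-cong (∏-cong m f≈a) (∏-cong m′ (λ q q<m′ → f≈b _ q (total q<m′) q<m′)) ⟩
    ∏ m a * ∏ m′ b ∎
    where
    open ≈-Reasoning
    back : ∀ i q → suc (i ℕ.+ q) ≡ m′ → i ≡ m′ ∸ suc q
    back i q refl = sym (ℕP.m+n∸n≡m i q)
    total : ∀ {q} → q ℕ.< m′ → m ℕ.+ (m′ ∸ suc q) ℕ.+ suc q ≡ n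
    total {q} q<m′ = trans (ℕP.+-assoc m (m′ ∸ suc q) (suc q))
      (trans (cong (m ℕ.+_) (ℕP.m∸n+n≡m q<m′)) (sym n≡m+m′))

  double-suc : ∀ i → + 2 * + suc i ≡ + even+ i
  double-suc i = trans (sym (ℤP.pos-* 2 (suc i))) (cong +_ (identity i))
    where
    identity : ∀ i → 2 ℕ.* suc i ≡ suc (suc (i ℕ.+ i))
    identity = ℕSolver.solve-∀

  double-suc-mod : ∀ i q → i ℕ.+ suc q ≡ n → + 2 * + suc i ≈ - + odd q
  double-suc-mod i q i+q+1≡n = ≈-trans (≈-reflexive (double-suc i)) (complement (even+ i) (odd q)
    (trans (identity i q) (trans (cong (λ k → suc (k ℕ.+ k)) i+q+1≡n) (sym p≡2n+1))))
    where
    identity : ∀ i q → suc (suc (i ℕ.+ i)) ℕ.+ suc (q ℕ.+ q) ≡ suc ((i ℕ.+ suc q) ℕ.+ (i ℕ.+ suc q))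
    identity = ℕSolver.solve-∀

  linear⁺ : ∀ j {a b} → a ≈ b → a + + 1 * j ≈ j + b
  linear⁺ j {a} a≈b = ≈-trans (≈-reflexive (identity a j)) (+-cong (≈-refl {j}) a≈b)
    where
    identity : ∀ a j → a + + 1 * j ≡ j + a
    identity = solve-∀

  linear⁻ : ∀ j {a b} → a ≈ b → a + - + 1 * j ≈ - (j - b)
  linear⁻ j {a} a≈b = ≈-trans (≈-reflexive (identity a j)) (-‿cong (+-cong (≈-refl {j}) (-‿cong a≈b)))
    where
    identity : ∀ a j → a + - + 1 * j ≡ - (j - a)
    identity = solve-∀

  evens odds E-evens E-odds : ℤ
  evens   = ∏ m  (λ i → + even+ i)
  odds    = ∏ m′ (λ q → + odd q)
  E-evens = ∏ m  (λ i → E (even+ i))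
  E-odds  = ∏ m′ (λ q → E (odd q))

  ∏-P : ∀ k (s : ℕ → ℕ) → (∀ i → i ℕ.< k → s i ℕ.≤ n) → ∏ k (P ∘ s) * sq (∏ k (E ∘ s)) ≈ + 1
  ∏-P k s s≤n = begin
    ∏ k (P ∘ s) * sq (∏ k (E ∘ s))     ≡⟨ cong (∏ k (P ∘ s) *_) (∏-sq k (E ∘ s)) ⟨
    ∏ k (P ∘ s) * ∏ k (sq ∘ E ∘ s)     ≡⟨ ∏-distrib-* k (P ∘ s) (sq ∘ E ∘ s) ⟨
    ∏ k (λ i → P (s i) * sq (E (s i))) ≈⟨ ∏-ones k (λ i i<k → P-E (s≤n i i<k)) ⟩
    + 1                                ∎
    where open ≈-Reasoning

  ∏-Q : ∀ k (s : ℕ → ℕ) → (∀ i → i ℕ.< k → s i ℕ.< n) →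
    ∏ k (Q ∘ suc ∘ s) * sq (∏ k (+_ ∘ suc ∘ s)) ≈ sq (∏ k (E ∘ suc ∘ s))
  ∏-Q k s s<n = begin
    ∏ k (Q ∘ suc ∘ s) * sq (∏ k (+_ ∘ suc ∘ s))       ≡⟨ cong (∏ k (Q ∘ suc ∘ s) *_) (∏-sq k (+_ ∘ suc ∘ s)) ⟨
    ∏ k (Q ∘ suc ∘ s) * ∏ k (sq ∘ +_ ∘ suc ∘ s)       ≡⟨ ∏-distrib-* k (Q ∘ suc ∘ s) _ ⟨
    ∏ k (λ i → Q (suc (s i)) * sq (+ suc (s i)))      ≈⟨ ∏-cong k (λ i i<k → Q-E (s<n i i<k)) ⟩
    ∏ k (sq ∘ E ∘ suc ∘ s)                            ≡⟨ ∏-sq k (E ∘ suc ∘ s) ⟩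
    sq (∏ k (E ∘ suc ∘ s))                            ∎
    where open ≈-Reasoning

  -- For δ = 1 the rows with 2i ≡ s even are of type `P`, those with 2i ≡ -s, s odd, of type `Q`. So
  -- the even s contribute denominators and the odd s numerators.
  ℳ⁺ : ℳ (+ 1) * (sq E-evens * sq odds) ≈ sq E-odds
  ℳ⁺ = begin
    ℳ (+ 1) * (sq E-evens * sq odds)
      ≈⟨ *-congʳ _ (parity-split
           (λ i _ → ∏-cong n (λ j _ → M-cong (linear⁺ (+ suc j) (≈-reflexive (double-suc i)))))
           (λ i q eq _ → ∏-cong n (λ j _ → M-cong (linear⁺ (+ suc j) (double-suc-mod i q eq))))) ⟩
    ∏ m (P ∘ even+) * ∏ m′ (Q ∘ odd) * (sq E-evens * sq odds)
      ≡⟨ *-interchange (∏ m (P ∘ even+)) _ (sq E-evens) _ ⟩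
    ∏ m (P ∘ even+) * sq E-evens * (∏ m′ (Q ∘ odd) * sq odds)
      ≈⟨ *-cong (∏-P m even+ (λ i → even+≤n)) (∏-Q m′ (λ q → q ℕ.+ q) (λ q → odd≤n)) ⟩
    + 1 * sq E-odds
      ≡⟨ ℤP.*-identityˡ _ ⟩
    sq E-odds ∎
    where open ≈-Reasoning

  -- For δ = -1 we have u(i,j) = -(j - 2i). The outer sign is lost in `M`, and the types `P` and `Q`
  -- change places.
  ℳ⁻ : ℳ (- + 1) * (sq evens * sq E-odds) ≈ sq E-evens
  ℳ⁻ = begin
    ℳ (- + 1) * (sq evens * sq E-odds)
      ≈⟨ *-congʳ _ (parity-split
           (λ i _ → ∏-cong n (λ j _ → reflected (linear⁻ (+ suc j) (≈-reflexive (double-suc i)))))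
           (λ i q eq _ → ∏-cong n (λ j _ → ≈-trans (reflected (linear⁻ (+ suc j) (double-suc-mod i q eq)))
              (≈-reflexive (cong (λ c → M (+ suc j + c)) (ℤP.neg-involutive (+ odd q))))))) ⟩
    ∏ m (Q ∘ even+) * ∏ m′ (P ∘ odd) * (sq evens * sq E-odds)
      ≡⟨ *-interchange (∏ m (Q ∘ even+)) _ (sq evens) _ ⟩
    ∏ m (Q ∘ even+) * sq evens * (∏ m′ (P ∘ odd) * sq E-odds)
      ≈⟨ *-cong (∏-Q m (λ i → suc (i ℕ.+ i)) (λ i → even+≤n)) (∏-P m′ odd (λ q → odd≤n)) ⟩
    sq E-evens * + 1
      ≡⟨ ℤP.*-identityʳ _ ⟩
    sq E-evens ∎
    where
    open ≈-Reasoning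
    reflected : ∀ {x y} → x ≈ - y → M x ≈ M y
    reflected {x} {y} x≈-y = ≈-trans (M-cong x≈-y) (≈-reflexive (M-neg y))

  K-zero : ∀ δ i j → linear δ i j ≈ + 0 → K δ i j ≈ - (+ 3 * i)
  K-zero δ i j = ≈-reflexive ∘ ifzero-yes (- (+ 3 * i)) (+ 1)

  K-unit : ∀ δ i j → linear δ i j ≉ + 0 → K δ i j ≈ + 1
  K-unit δ i j = ≈-reflexive ∘ ifzero-no (- (+ 3 * i)) (+ 1)

  -- If 2i ≡ s with 1 ≤ s ≤ n, then u(i,j) = 2i - j vanishes only at j = s; if 2i ≡ -s, then never.
  K⁻-row : ∀ i s → suc s ℕ.≤ n → + 2 * + suc i ≈ + suc s →
    ∏ n (entry (- + 1) K i) ≈ - (+ 3 * + suc i)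
  K⁻-row i s s<n 2i≈s = ≈-trans
    (∏-single n s s<n (λ j j<n j≢s → K-unit (- + 1) (+ suc i) (+ suc j) (j≢s ∘ unique j<n)))
    (K-zero (- + 1) (+ suc i) (+ suc s)
      (≈-trans (linear⁻ (+ suc s) 2i≈s) (≈-reflexive (cong -_ (ℤP.+-inverseʳ (+ suc s))))))
    where
    unique : ∀ {j} → j ℕ.< n → linear (- + 1) (+ suc i) (+ suc j) ≈ + 0 → j ≡ s
    unique {j} j<n u≈0 = ℕP.suc-injective (small-injective (≤n⇒<p j<n) (≤n⇒<p s<n)
      (-≈0⇒≈ (neg≈0 (≈-trans (≈-sym (linear⁻ (+ suc j) 2i≈s)) u≈0))))

  K⁻-row-trivial : ∀ i s → s ℕ.≤ n → + 2 * + suc i ≈ - + s → ∏ n (entry (- + 1) K i) ≈ + 1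
  K⁻-row-trivial i s s≤n 2i≈-s = ∏-ones n (λ j j<n → K-unit (- + 1) (+ suc i) (+ suc j) (λ u≈0 →
    ≤2n⇒≉0 (ℕ.s≤s ℕ.z≤n) (ℕP.+-mono-≤ j<n s≤n)
      (≈-trans (≈-reflexive (cong (λ c → + suc j + c) (sym (ℤP.neg-involutive (+ s)))))
        (neg≈0 (≈-trans (≈-sym (linear⁻ (+ suc j) 2i≈-s)) u≈0)))))

  -- The mirror image for u(i,j) = 2i + j, which can vanish only in the rows with 2i ≡ -s, namely at
  -- j = s.
  K⁺-row : ∀ i s → suc s ℕ.≤ n → + 2 * + suc i ≈ - + suc s →
    ∏ n (entry (+ 1) K i) ≈ - (+ 3 * + suc i)
  K⁺-row i s s<n 2i≈-s = ≈-trans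
    (∏-single n s s<n (λ j j<n j≢s → K-unit (+ 1) (+ suc i) (+ suc j) (j≢s ∘ unique j<n)))
    (K-zero (+ 1) (+ suc i) (+ suc s)
      (≈-trans (linear⁺ (+ suc s) 2i≈-s) (≈-reflexive (ℤP.+-inverseʳ (+ suc s)))))
    where
    unique : ∀ {j} → j ℕ.< n → linear (+ 1) (+ suc i) (+ suc j) ≈ + 0 → j ≡ s
    unique {j} j<n u≈0 = ℕP.suc-injective (small-injective (≤n⇒<p j<n) (≤n⇒<p s<n)
      (-≈0⇒≈ (≈-trans (≈-sym (linear⁺ (+ suc j) 2i≈-s)) u≈0)))

  K⁺-row-trivial : ∀ i s → s ℕ.≤ n → + 2 * + suc i ≈ + s → ∏ n (entry (+ 1) K i) ≈ + 1
  K⁺-row-trivial i s s≤n 2i≈s = ∏-ones n (λ j j<n → K-unit (+ 1) (+ suc i) (+ suc j) (λ u≈0 →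
    ≤2n⇒≉0 (ℕ.s≤s ℕ.z≤n) (ℕP.+-mono-≤ j<n s≤n)
      (≈-trans (≈-sym (linear⁺ (+ suc j) 2i≈s)) u≈0)))

  -- Each row with a zero contributes -3i with 2i = s even. One factor 2 per such row turns this
  -- into -3s.
  𝒦⁻ : (+ 2) ^ m * 𝒦 (- + 1) ≈ (- + 3) ^ m * evens
  𝒦⁻ = begin
    (+ 2) ^ m * 𝒦 (- + 1)
      ≈⟨ *-congˡ ((+ 2) ^ m) (parity-split
           (λ i i<m → K⁻-row i (suc (i ℕ.+ i)) (even+≤n i<m) (≈-reflexive (double-suc i)))
           (λ i q eq q<m′ → K⁻-row-trivial i (odd q) (odd≤n q<m′) (double-suc-mod i q eq))) ⟩
    (+ 2) ^ m * (∏ m row * ∏ m′ (λ _ → + 1))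
      ≡⟨ cong ((+ 2) ^ m *_) (trans (cong (∏ m row *_) (∏-one m′)) (ℤP.*-identityʳ (∏ m row))) ⟩
    (+ 2) ^ m * ∏ m row
      ≡⟨ trans (∏-distrib-* m (λ _ → + 2) row) (cong (_* ∏ m row) (∏-const m (+ 2))) ⟨
    ∏ m (λ i → + 2 * row i)
      ≡⟨ ∏-cong-≡ m (λ i → trans (identity (+ suc i)) (cong (- + 3 *_) (double-suc i))) ⟩
    ∏ m (λ i → - + 3 * + even+ i)
      ≡⟨ trans (∏-distrib-* m (λ _ → - + 3) _) (cong (_* evens) (∏-const m (- + 3))) ⟩
    (- + 3) ^ m * evens ∎
    where
    open ≈-Reasoning
    row : ℕ → ℤ
    row i = - (+ 3 * + suc i)
    identity : ∀ i → + 2 * - (+ 3 * i) ≡ - + 3 * (+ 2 * i)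
    identity = solve-∀

  -- Now the zeros lie in the rows with 2i ≡ -s, s odd, and 2 · (-3i) ≡ 3s. The row index is
  -- rewritten through q, where s = 2q + 1.
  𝒦⁺ : (+ 2) ^ m′ * 𝒦 (+ 1) ≈ (+ 3) ^ m′ * odds
  𝒦⁺ = begin
    (+ 2) ^ m′ * 𝒦 (+ 1)
      ≈⟨ *-congˡ ((+ 2) ^ m′) (parity-split
           (λ i i<m → K⁺-row-trivial i (even+ i) (even+≤n i<m) (≈-reflexive (double-suc i)))
           (λ i q eq q<m′ → ≈-trans (K⁺-row i (q ℕ.+ q) (odd≤n q<m′) (double-suc-mod i q eq))
              (≈-reflexive (cong row (index i q eq))))) ⟩
    (+ 2) ^ m′ * (∏ m (λ _ → + 1) * ∏ m′ row′)
      ≡⟨ cong ((+ 2) ^ m′ *_) (trans (cong (_* ∏ m′ row′) (∏-one m)) (ℤP.*-identityˡ (∏ m′ row′))) ⟩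
    (+ 2) ^ m′ * ∏ m′ row′
      ≡⟨ trans (∏-distrib-* m′ (λ _ → + 2) row′) (cong (_* ∏ m′ row′) (∏-const m′ (+ 2))) ⟨
    ∏ m′ (λ q → + 2 * row′ q)
      ≈⟨ ∏-cong m′ (λ q q<m′ → ≈-trans (≈-reflexive (identity (+ suc (n ∸ suc q))))
           (*-congˡ (- + 3) (double-suc-mod (n ∸ suc q) q (ℕP.m∸n+n≡m (q<n q<m′))))) ⟩
    ∏ m′ (λ q → - + 3 * - + odd q)
      ≡⟨ ∏-cong-≡ m′ (λ q → signs (+ odd q)) ⟩
    ∏ m′ (λ q → + 3 * + odd q)
      ≡⟨ trans (∏-distrib-* m′ (λ _ → + 3) _) (cong (_* odds) (∏-const m′ (+ 3))) ⟩
    (+ 3) ^ m′ * odds ∎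
    where
    open ≈-Reasoning
    row row′ : ℕ → ℤ
    row i = - (+ 3 * + suc i)
    row′ q = row (n ∸ suc q)
    identity : ∀ i → + 2 * - (+ 3 * i) ≡ - + 3 * (+ 2 * i)
    identity = solve-∀
    signs : ∀ i → - + 3 * - i ≡ + 3 * i
    signs = solve-∀
    index : ∀ i q → i ℕ.+ suc q ≡ n → i ≡ n ∸ suc q
    index i q eq = trans (sym (ℕP.m+n∸n≡m i (suc q))) (cong (_∸ suc q) eq)
    q<n : ∀ {q} → q ℕ.< m′ → suc q ℕ.≤ n
    q<n {q} q<m′ = ℕP.≤-trans (ℕ.s≤s (ℕP.m≤m+n q q)) (odd≤n q<m′)

  -- `T-linear` multiplied by the denominators of 𝒦 and ℳ, so that `𝒦⁻` and `ℳ⁻` can be substituted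
  -- without dividing.
  T⁻ : T p (- + 1) * sq ((- + 3) ^ m * evens * evens * E-odds) ≈ ((- + 1) ^ n) ^ n * sq ((+ 2) ^ m * E-evens)
  T⁻ = begin
    T p (- + 1) * sq ((- + 3) ^ m * evens * evens * E-odds)
      ≡⟨ split₁ (T p (- + 1)) ((- + 3) ^ m * evens) evens E-odds ⟩
    T p (- + 1) * (sq ((- + 3) ^ m * evens) * (sq evens * sq E-odds))
      ≈⟨ *-congˡ (T p (- + 1)) (*-congʳ (sq evens * sq E-odds) (sq-cong 𝒦⁻)) ⟨
    T p (- + 1) * (sq ((+ 2) ^ m * 𝒦 (- + 1)) * (sq evens * sq E-odds))
      ≡⟨ split₂ (T p (- + 1)) ((+ 2) ^ m) (𝒦 (- + 1)) (sq evens * sq E-odds) ⟩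
    T p (- + 1) * sq (𝒦 (- + 1)) * (sq ((+ 2) ^ m) * (sq evens * sq E-odds))
      ≈⟨ *-congʳ _ (T-linear { - + 1} refl) ⟩
    ((- + 1) ^ n) ^ n * ℳ (- + 1) * (sq ((+ 2) ^ m) * (sq evens * sq E-odds))
      ≡⟨ split₃ (((- + 1) ^ n) ^ n) (ℳ (- + 1)) (sq ((+ 2) ^ m)) _ ⟩
    ((- + 1) ^ n) ^ n * (sq ((+ 2) ^ m) * (ℳ (- + 1) * (sq evens * sq E-odds)))
      ≈⟨ *-congˡ (((- + 1) ^ n) ^ n) (*-congˡ (sq ((+ 2) ^ m)) ℳ⁻) ⟩
    ((- + 1) ^ n) ^ n * (sq ((+ 2) ^ m) * sq E-evens)
      ≡⟨ cong (((- + 1) ^ n) ^ n *_) (sq-* ((+ 2) ^ m) E-evens) ⟨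
    ((- + 1) ^ n) ^ n * sq ((+ 2) ^ m * E-evens) ∎
    where open ≈-Reasoning

  T⁺ : T p (+ 1) * sq ((+ 3) ^ m′ * odds * E-evens * odds) ≈ sq ((+ 2) ^ m′ * E-odds)
  T⁺ = begin
    T p (+ 1) * sq ((+ 3) ^ m′ * odds * E-evens * odds)
      ≡⟨ split₁ (T p (+ 1)) ((+ 3) ^ m′ * odds) E-evens odds ⟩
    T p (+ 1) * (sq ((+ 3) ^ m′ * odds) * (sq E-evens * sq odds))
      ≈⟨ *-congˡ (T p (+ 1)) (*-congʳ (sq E-evens * sq odds) (sq-cong 𝒦⁺)) ⟨
    T p (+ 1) * (sq ((+ 2) ^ m′ * 𝒦 (+ 1)) * (sq E-evens * sq odds))
      ≡⟨ split₂ (T p (+ 1)) ((+ 2) ^ m′) (𝒦 (+ 1)) (sq E-evens * sq odds) ⟩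
    T p (+ 1) * sq (𝒦 (+ 1)) * (sq ((+ 2) ^ m′) * (sq E-evens * sq odds))
      ≈⟨ *-congʳ _ (T-linear {+ 1} refl) ⟩
    ((+ 1) ^ n) ^ n * ℳ (+ 1) * (sq ((+ 2) ^ m′) * (sq E-evens * sq odds))
      ≡⟨ cong (λ z → z * ℳ (+ 1) * (sq ((+ 2) ^ m′) * (sq E-evens * sq odds)))
           (trans (cong (_^ n) (ℤP.^-zeroˡ n)) (ℤP.^-zeroˡ n)) ⟩
    + 1 * ℳ (+ 1) * (sq ((+ 2) ^ m′) * (sq E-evens * sq odds))
      ≡⟨ trans (split₃ (+ 1) (ℳ (+ 1)) (sq ((+ 2) ^ m′)) _) (ℤP.*-identityˡ _) ⟩
    sq ((+ 2) ^ m′) * (ℳ (+ 1) * (sq E-evens * sq odds))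
      ≈⟨ *-congˡ (sq ((+ 2) ^ m′)) ℳ⁺ ⟩
    sq ((+ 2) ^ m′) * sq E-odds
      ≡⟨ sq-* ((+ 2) ^ m′) E-odds ⟨
    sq ((+ 2) ^ m′ * E-odds) ∎
    where open ≈-Reasoning

-- The two residue classes of p modulo 4

evens-odds-! : ∀ m → ∏ m (λ i → + even+ i) * ∏ m (λ q → + odd q) ≡ + ((m ℕ.+ m) !)
evens-odds-! zero    = refl
evens-odds-! (suc m) = begin
  ∏ (suc m) e * ∏ (suc m) o          ≡⟨ cong₂ _*_ (∏-last m e) (∏-last m o) ⟩
  ∏ m e * e m * (∏ m o * o m)        ≡⟨ rearrange (∏ m e) (e m) (∏ m o) (o m) ⟩
  e m * (o m * (∏ m e * ∏ m o))      ≡⟨ cong (λ c → e m * (o m * c)) (evens-odds-! m) ⟩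
  e m * (o m * + ((m ℕ.+ m) !))      ≡⟨ trans (suc-! (odd m)) (cong (e m *_) (suc-! (m ℕ.+ m))) ⟨
  + (even+ m !)                      ≡⟨ cong (λ k → + (suc k !)) (ℕP.+-suc m m) ⟨
  + ((suc m ℕ.+ suc m) !)            ∎
  where
  open ≡-Reasoning
  e o : ℕ → ℤ
  e i = + even+ i
  o q = + odd q
  rearrange : ∀ a b c d → a * b * (c * d) ≡ b * (d * (a * c))
  rearrange = solve-∀

sq-^ : ∀ a m → sq (a ^ m) ≡ a ^ (m ℕ.+ m)
sq-^ a m = sym (ℤP.^-distribˡ-+-* a m m)

sq-neg-^ : ∀ a m → sq ((- a) ^ m) ≡ sq (a ^ m)
sq-neg-^ a m = begin
  sq ((- a) ^ m)  ≡⟨ ^-distribʳ-* m (- a) (- a) ⟨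
  sq (- a) ^ m    ≡⟨ cong (_^ m) (sq-neg a) ⟩
  sq a ^ m        ≡⟨ ^-distribʳ-* m a a ⟩
  sq (a ^ m)      ∎
  where open ≡-Reasoning

[-1]^2m≡1 : ∀ m → (- + 1) ^ (m ℕ.+ m) ≡ + 1
[-1]^2m≡1 m = trans (sym (sq-^ (- + 1) m)) (sq-sign m)

module EvenCase (p : ℕ) (prime : Prime p) (m : ℕ) (p≡4m+1 : p ≡ suc ((m ℕ.+ m) ℕ.+ (m ℕ.+ m)))
                (3≉0 : Congruence._≉_ p (+ 3) (+ 0)) where
  open PrimeModulus p prime
  private
    n : ℕ
    n = m ℕ.+ m
  open Rows p prime n p≡4m+1 3≉0
  open RowProducts p prime n p≡4m+1 3≉0
  open Parity p prime n p≡4m+1 3≉0 m m refl ℕP.≤-refl (ℕP.n≤1+n m)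

  evens*odds≡n! : evens * odds ≡ + (n !)
  evens*odds≡n! = evens-odds-! m

  E-evens≉0 : E-evens ≉ + 0
  E-evens≉0 = ∏≉0 m (λ i i<m → E≉0 (even+≤n i<m))

  odds≉0 : odds ≉ + 0
  odds≉0 = ∏≉0 m (λ q q<m → small≉0 (ℕ.s≤s ℕ.z≤n) (≤n⇒<p (odd≤n q<m)))

  -- Passing from s = 2r+1 to s + 1 multiplies E by (s+1)/(n-s). As n is even, the numbers n - s run
  -- through the odd numbers again, in reverse order.
  E-odds*evens : E-odds * evens ≈ E-evens * odds
  E-odds*evens = begin
    E-odds * evens                                        ≡⟨ ∏-distrib-* m (E ∘ odd) (+_ ∘ even+) ⟨
    ∏ m (λ r → E (odd r) * + even+ r)                     ≈⟨ ∏-cong m (λ r r<m → ≈-reflexive (shift-factor r (even+≤n r<m))) ⟩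
    ∏ m (λ r → E (even+ r) * + (n ∸ odd r))               ≡⟨ ∏-distrib-* m (E ∘ even+) _ ⟩
    E-evens * ∏ m (λ r → + (n ∸ odd r))                   ≡⟨ cong (E-evens *_) (∏-reverse m _ (+_ ∘ odd) (λ i j eq → cong +_ (reflect i j eq))) ⟩
    E-evens * odds                                        ∎
    where
    open ≈-Reasoning
    rearrange : ∀ a b c d → a * (b * c) * d ≡ (d * a) * c * b
    rearrange = solve-∀
    shift-factor : ∀ r → suc (odd r) ℕ.≤ n → E (odd r) * + even+ r ≡ E (even+ r) * + (n ∸ odd r)
    shift-factor r r<n = trans (cong (λ c → + (odd r !) * c * + even+ r) above)
      (trans (rearrange (+ (odd r !)) (+ (n ∸ odd r)) (+ ((n ∸ even+ r) !)) (+ even+ r))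
        (cong (λ c → c * + ((n ∸ even+ r) !) * + (n ∸ odd r)) (sym (suc-! (odd r)))))
      where
      above : + ((n ∸ odd r) !) ≡ + (n ∸ odd r) * + ((n ∸ even+ r) !)
      above = subst (λ k → + (k !) ≡ + k * + ((n ∸ even+ r) !)) (sym (ℕP.+-∸-assoc 1 r<n)) (suc-! (n ∸ even+ r))
    reflect : ∀ i j → suc (i ℕ.+ j) ≡ m → n ∸ odd i ≡ odd j
    reflect i j refl = trans (cong (_∸ odd i) (identity i j)) (ℕP.m+n∸m≡n (odd i) (odd j))
      where
      identity : ∀ i j → suc (i ℕ.+ j) ℕ.+ suc (i ℕ.+ j) ≡ suc (i ℕ.+ i) ℕ.+ suc (j ℕ.+ j)
      identity = ℕSolver.solve-∀

  sq-n! : sq (+ (n !)) ≈ - + 1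
  sq-n! = ≈-trans sq-half-! (≈-reflexive (cong (- + 1 *_) ([-1]^2m≡1 m)))

  private
    -- The minus sign on the right is n!² ≡ -1, which holds because n is even.
    finish : ∀ t → t * sq ((+ 3) ^ m * + (n !)) ≈ sq ((+ 2) ^ m) → t * (+ 3) ^ n ≈ - ((+ 2) ^ n)
    finish t eq = begin
      t * (+ 3) ^ n                          ≡⟨ cong (t *_) (sq-^ (+ 3) m) ⟨
      t * sq ((+ 3) ^ m)                     ≡⟨ negate t (sq ((+ 3) ^ m)) ⟩
      - (t * (sq ((+ 3) ^ m) * - + 1))       ≈⟨ -‿cong (*-congˡ t (*-congˡ (sq ((+ 3) ^ m)) sq-n!)) ⟨
      - (t * (sq ((+ 3) ^ m) * sq (+ (n !)))) ≡⟨ cong (λ c → - (t * c)) (sq-* ((+ 3) ^ m) (+ (n !))) ⟨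
      - (t * sq ((+ 3) ^ m * + (n !)))       ≈⟨ -‿cong eq ⟩
      - sq ((+ 2) ^ m)                       ≡⟨ cong -_ (sq-^ (+ 2) m) ⟩
      - ((+ 2) ^ n)                          ∎
      where
      open ≈-Reasoning
      negate : ∀ a b → a * b ≡ - (a * (b * - + 1))
      negate = solve-∀

  T⁻*3^n : T p (- + 1) * (+ 3) ^ n ≈ - ((+ 2) ^ n)
  T⁻*3^n = finish (T p (- + 1)) (*-cancelˡ (sq E-evens) (*≉0 E-evens≉0 E-evens≉0) (begin
    sq E-evens * (T p (- + 1) * sq ((+ 3) ^ m * + (n !)))
      ≡⟨ cong (λ c → sq E-evens * (T p (- + 1) * sq ((+ 3) ^ m * c))) evens*odds≡n! ⟨
    sq E-evens * (T p (- + 1) * sq ((+ 3) ^ m * (evens * odds)))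
      ≡⟨ rearrange E-evens (T p (- + 1)) ((+ 3) ^ m) evens odds ⟩
    T p (- + 1) * (sq ((+ 3) ^ m) * sq (evens * (E-evens * odds)))
      -- The relation between `E-odds` and `E-evens` produces the left-hand side of `T⁻`; squaring
      -- makes 3 and -3 interchangeable.
      ≈⟨ *-congˡ (T p (- + 1)) (*-cong (≈-reflexive (sq-neg-^ (+ 3) m)) (sq-cong (*-congˡ evens E-odds*evens))) ⟨
    T p (- + 1) * (sq ((- + 3) ^ m) * sq (evens * (E-odds * evens)))
      ≡⟨ regroup (T p (- + 1)) ((- + 3) ^ m) evens E-odds ⟩
    T p (- + 1) * sq ((- + 3) ^ m * evens * evens * E-odds)
      ≈⟨ T⁻ ⟩
    ((- + 1) ^ n) ^ n * sq ((+ 2) ^ m * E-evens)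
      ≡⟨ cong (_* sq ((+ 2) ^ m * E-evens)) (trans (cong (_^ n) ([-1]^2m≡1 m)) (ℤP.^-zeroˡ n)) ⟩
    + 1 * sq ((+ 2) ^ m * E-evens)
      ≡⟨ commute ((+ 2) ^ m) E-evens ⟩
    sq E-evens * sq ((+ 2) ^ m) ∎))
    where
    open ≈-Reasoning
    rearrange : ∀ e t a v d → (e * e) * (t * ((a * (v * d)) * (a * (v * d)))) ≡ t * ((a * a) * ((v * (e * d)) * (v * (e * d))))
    rearrange = solve-∀
    regroup : ∀ t a v o → t * ((a * a) * ((v * (o * v)) * (v * (o * v)))) ≡ t * ((a * v * v * o) * (a * v * v * o))
    regroup = solve-∀
    commute : ∀ a e → + 1 * ((a * e) * (a * e)) ≡ (e * e) * (a * a)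
    commute = solve-∀

  T⁺*3^n : T p (+ 1) * (+ 3) ^ n ≈ - ((+ 2) ^ n)
  T⁺*3^n = finish (T p (+ 1)) (*-cancelˡ (sq (E-evens * odds)) (*≉0 E*odds≉0 E*odds≉0) (begin
    sq (E-evens * odds) * (T p (+ 1) * sq ((+ 3) ^ m * + (n !)))
      ≡⟨ cong (λ c → sq (E-evens * odds) * (T p (+ 1) * sq ((+ 3) ^ m * c))) evens*odds≡n! ⟨
    sq (E-evens * odds) * (T p (+ 1) * sq ((+ 3) ^ m * (evens * odds)))
      ≡⟨ rearrange E-evens (T p (+ 1)) ((+ 3) ^ m) evens odds ⟩
    sq evens * (T p (+ 1) * sq ((+ 3) ^ m * odds * E-evens * odds))
      ≈⟨ *-congˡ (sq evens) T⁺ ⟩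
    sq evens * sq ((+ 2) ^ m * E-odds)
      ≡⟨ regroup evens ((+ 2) ^ m) E-odds ⟩
    sq (E-odds * evens) * sq ((+ 2) ^ m)
      ≈⟨ *-congʳ (sq ((+ 2) ^ m)) (sq-cong E-odds*evens) ⟩
    sq (E-evens * odds) * sq ((+ 2) ^ m) ∎))
    where
    open ≈-Reasoning
    E*odds≉0 : E-evens * odds ≉ + 0
    E*odds≉0 = *≉0 E-evens≉0 odds≉0
    rearrange : ∀ e t a v d → ((e * d) * (e * d)) * (t * ((a * (v * d)) * (a * (v * d)))) ≡ (v * v) * (t * ((a * d * e * d) * (a * d * e * d)))
    rearrange = solve-∀
    regroup : ∀ v a o → (v * v) * ((a * o) * (a * o)) ≡ ((o * v) * (o * v)) * (a * a)
    regroup = solve-∀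

  -- Gauss's lemma for 2: the doubles of 1, ..., n are the even numbers up to n and the negatives of
  -- the m odd ones, so both sides agree after multiplication by n!.
  2^n : (+ 2) ^ n ≈ (- + 1) ^ m
  2^n = *-cancelˡ (+ (n !)) (!≉0 n (≤n⇒<p ℕP.≤-refl)) (begin
    + (n !) * (+ 2) ^ n                          ≡⟨ ℤP.*-comm (+ (n !)) _ ⟩
    (+ 2) ^ n * + (n !)                          ≡⟨ cong₂ _*_ (∏-const n (+ 2)) (∏-! n) ⟨
    ∏ n (λ _ → + 2) * ∏ n (λ i → + suc i)        ≡⟨ ∏-distrib-* n (λ _ → + 2) _ ⟨
    ∏ n (λ i → + 2 * + suc i)                    ≈⟨ parity-split (λ i _ → ≈-reflexive (double-suc i)) (λ i q eq _ → ≈-trans (double-suc-mod i q eq) (≈-reflexive (sym (ℤP.-1*i≡-i (+ odd q))))) ⟩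
    evens * ∏ m (λ q → - + 1 * + odd q)          ≡⟨ cong (evens *_) (trans (∏-distrib-* m (λ _ → - + 1) _) (cong (_* odds) (∏-const m (- + 1)))) ⟩
    evens * ((- + 1) ^ m * odds)                 ≡⟨ rearrange evens ((- + 1) ^ m) odds ⟩
    evens * odds * (- + 1) ^ m                   ≡⟨ cong (_* (- + 1) ^ m) evens*odds≡n! ⟩
    + (n !) * (- + 1) ^ m                        ∎)
    where
    open ≈-Reasoning
    rearrange : ∀ a b c → a * (b * c) ≡ a * c * b
    rearrange = solve-∀

-- The case p ≡ 3 modulo 4 and the central binomial coefficient

central-binomial : ∀ m → + ((m ℕ.+ m) C m) * (+ (m !) * + (m !)) ≡ + ((m ℕ.+ m) !)
central-binomial m = begin
  + ((m ℕ.+ m) C m) * (+ (m !) * + (m !))   ≡⟨ trans (cong (+ ((m ℕ.+ m) C m) *_) (sym (ℤP.pos-* (m !) (m !)))) (sym (ℤP.pos-* ((m ℕ.+ m) C m) _)) ⟩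
  + (((m ℕ.+ m) C m) ℕ.* (m ! ℕ.* m !))       ≡⟨ cong (λ k → + (((m ℕ.+ m) C m) ℕ.* (m ! ℕ.* k !))) (ℕP.m+n∸m≡n m m) ⟨
  + (((m ℕ.+ m) C m) ℕ.* (m ! ℕ.* (m ℕ.+ m ∸ m) !))  ≡⟨ cong +_ (trans (cong (λ k → k ℕ.* (m ! ℕ.* (m ℕ.+ m ∸ m) !)) (nCk≡n!/k![n-k]! m≤2m)) (m/n*n≡m (k![n∸k]!∣n! m≤2m))) ⟩
  + ((m ℕ.+ m) !)                           ∎
  where
  open ≡-Reasoning
  m≤2m : m ℕ.≤ m ℕ.+ m
  m≤2m = ℕP.m≤m+n m m
  instance
    _ = (m ℕP.!* (m ℕ.+ m ∸ m) !≢0)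

module OddCase (p : ℕ) (prime : Prime p) (m : ℕ) (p≡4m+3 : p ≡ suc (suc (m ℕ.+ m) ℕ.+ suc (m ℕ.+ m)))
               (3≉0 : Congruence._≉_ p (+ 3) (+ 0)) where
  open PrimeModulus p prime
  open Euler p prime
  private
    n : ℕ
    n = suc (m ℕ.+ m)
    2^m 3^m m! : ℤ
    2^m = (+ 2) ^ m
    3^m = (+ 3) ^ m
    m!  = + (m !)
  open Rows p prime n p≡4m+3 3≉0
  open RowProducts p prime n p≡4m+3 3≉0
  open Parity p prime n p≡4m+3 3≉0 m (suc m) (sym (ℕP.+-suc m m)) (ℕP.n≤1+n m) ℕP.≤-refl

  2≉0 : + 2 ≉ + 0
  2≉0 = ≤2n⇒≉0 (ℕ.s≤s ℕ.z≤n) (ℕ.s≤s (subst (1 ℕ.≤_) (sym (ℕP.+-suc (m ℕ.+ m) (m ℕ.+ m))) (ℕ.s≤s ℕ.z≤n)))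

  m!≉0 : m! ≉ + 0
  m!≉0 = !≉0 m (≤n⇒<p (ℕP.m≤n⇒m≤1+n (ℕP.m≤m+n m m)))

  evens*odds≡n! : evens * odds ≡ + (n !)
  evens*odds≡n! = begin
    evens * odds                                       ≡⟨ cong (evens *_) (∏-last m (+_ ∘ odd)) ⟩
    evens * (∏ m (+_ ∘ odd) * + n)                     ≡⟨ rearrange evens _ (+ n) ⟩
    + n * (evens * ∏ m (+_ ∘ odd))                     ≡⟨ cong (+ n *_) (evens-odds-! m) ⟩
    + n * + ((m ℕ.+ m) !)                              ≡⟨ suc-! (m ℕ.+ m) ⟨
    + (n !)                                            ∎
    where
    open ≡-Reasoning
    rearrange : ∀ a b c → a * (b * c) ≡ c * (a * b)
    rearrange = solve-∀

  E-evens≉0 : E-evens ≉ + 0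
  E-evens≉0 = ∏≉0 m (λ i i<m → E≉0 (even+≤n i<m))

  evens≡2^m*m! : evens ≡ 2^m * m!
  evens≡2^m*m! = begin
    evens                              ≡⟨ ∏-cong-≡ m double-suc ⟨
    ∏ m (λ i → + 2 * + suc i)          ≡⟨ ∏-distrib-* m (λ _ → + 2) _ ⟩
    ∏ m (λ _ → + 2) * ∏ m (+_ ∘ suc)   ≡⟨ cong₂ _*_ (∏-const m (+ 2)) (∏-! m) ⟩
    2^m * m!                           ∎
    where open ≡-Reasoning

  E-symmetric : ∀ s r → s ℕ.+ r ≡ n → E s ≡ E r
  E-symmetric s r s+r≡n = begin
    + (s !) * + ((n ∸ s) !)  ≡⟨ cong (λ k → + (s !) * + (k !)) (trans (cong (_∸ s) (sym s+r≡n)) (ℕP.m+n∸m≡n s r)) ⟩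
    + (s !) * + (r !)        ≡⟨ ℤP.*-comm (+ (s !)) (+ (r !)) ⟩
    + (r !) * + (s !)        ≡⟨ cong (λ k → + (r !) * + (k !)) (trans (cong (_∸ r) (sym s+r≡n)) (ℕP.m+n∸n≡m s r)) ⟨
    + (r !) * + ((n ∸ r) !)  ∎
    where open ≡-Reasoning

  -- As n is odd, s ↦ n - s matches the odd s < n with the even numbers up to n. Only s = n remains,
  -- and E(n) = n! · 0!.
  E-odds≡ : E-odds ≡ E-evens * + (n !)
  E-odds≡ = begin
    E-odds                            ≡⟨ ∏-last m (E ∘ odd) ⟩
    ∏ m (E ∘ odd) * E n               ≡⟨ cong₂ _*_ (∏-reverse m (E ∘ odd) (E ∘ even+) reflect) E-n ⟩
    E-evens * + (n !)                 ∎
    where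
    open ≡-Reasoning
    E-n : E n ≡ + (n !)
    E-n = trans (cong (λ k → + (n !) * + (k !)) (ℕP.n∸n≡0 n)) (ℤP.*-identityʳ (+ (n !)))
    reflect : ∀ i j → suc (i ℕ.+ j) ≡ m → E (odd i) ≡ E (even+ j)
    reflect i j refl = E-symmetric (odd i) (even+ j) (identity i j)
      where
      identity : ∀ i j → suc (i ℕ.+ i) ℕ.+ suc (suc (j ℕ.+ j)) ≡ suc (suc (i ℕ.+ j) ℕ.+ suc (i ℕ.+ j))
      identity = ℕSolver.solve-∀

  [-1]^n : (- + 1) ^ n ≡ - + 1
  [-1]^n = cong (- + 1 *_) ([-1]^2m≡1 m)

  sq-n! : sq (+ (n !)) ≈ + 1
  sq-n! = ≈-trans sq-half-! (≈-reflexive (cong (- + 1 *_) [-1]^n))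

  T⁻-value : sq (3^m * 2^m * (m! * m!)) * T p (- + 1) ≈ - + 1
  T⁻-value = *-cancelˡ (sq (2^m * E-evens)) (*≉0 c≉0 c≉0) (begin
    sq (2^m * E-evens) * (sq (3^m * 2^m * (m! * m!)) * T p (- + 1))
      ≡⟨ rearrange 2^m E-evens 3^m m! (T p (- + 1)) ⟩
    T p (- + 1) * (sq 3^m * sq (2^m * m! * (2^m * m!) * E-evens) * + 1)
      -- The spare 1 becomes n!², which completes `E-evens` to `E-odds`.
      ≈⟨ *-congˡ (T p (- + 1)) (*-cong (*-congʳ _ (≈-reflexive (sym (sq-neg-^ (+ 3) m)))) (≈-sym sq-n!)) ⟩
    T p (- + 1) * (sq ((- + 3) ^ m) * sq (2^m * m! * (2^m * m!) * E-evens) * sq (+ (n !)))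
      ≡⟨ regroup (T p (- + 1)) ((- + 3) ^ m) (2^m * m!) E-evens (+ (n !)) ⟩
    T p (- + 1) * sq ((- + 3) ^ m * (2^m * m!) * (2^m * m!) * (E-evens * + (n !)))
      ≡⟨ cong₂ (λ v o → T p (- + 1) * sq ((- + 3) ^ m * v * v * o)) evens≡2^m*m! E-odds≡ ⟨
    T p (- + 1) * sq ((- + 3) ^ m * evens * evens * E-odds)
      ≈⟨ T⁻ ⟩
    ((- + 1) ^ n) ^ n * sq (2^m * E-evens)
      ≡⟨ cong (_* sq (2^m * E-evens)) (trans (cong (_^ n) [-1]^n) [-1]^n) ⟩
    - + 1 * sq (2^m * E-evens)
      ≡⟨ ℤP.*-comm (- + 1) _ ⟩
    sq (2^m * E-evens) * - + 1 ∎)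
    where
    open ≈-Reasoning
    c≉0 : 2^m * E-evens ≉ + 0
    c≉0 = *≉0 (^≉0 m 2≉0) E-evens≉0
    rearrange : ∀ a e b f t → ((a * e) * (a * e)) * (((b * a * (f * f)) * (b * a * (f * f))) * t) ≡
      t * ((b * b) * ((a * f * (a * f) * e) * (a * f * (a * f) * e)) * + 1)
    rearrange = solve-∀
    regroup : ∀ t b v e k → t * ((b * b) * ((v * v * e) * (v * v * e)) * (k * k)) ≡ t * ((b * v * v * (e * k)) * (b * v * v * (e * k)))
    regroup = solve-∀

  -- The fourth power of `odds` in `T⁺` is traded for that of `evens`, whose closed form 2^m m! is
  -- known.
  T⁺-value : sq (+ 3 * 3^m) * T p (+ 1) ≈ sq (+ 2 * 2^m * (2^m * m!) * (2^m * m!))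
  T⁺-value = subst (λ v → sq (+ 3 * 3^m) * T p (+ 1) ≈ sq (+ 2 * 2^m * v * v)) evens≡2^m*m!
    (*-cancelˡ (sq E-evens) (*≉0 E-evens≉0 E-evens≉0) (begin
    sq E-evens * (sq (+ 3 * 3^m) * T p (+ 1))
      ≡⟨ cong (sq E-evens *_) (ℤP.*-identityʳ _) ⟨
    sq E-evens * (sq (+ 3 * 3^m) * T p (+ 1) * sq (+ 1))
      -- The inserted 1 is n!⁴ = (evens · odds)⁴; its odd part supplies what `T⁺` requires.
      ≈⟨ *-congˡ (sq E-evens) (*-congˡ (sq (+ 3 * 3^m) * T p (+ 1)) (sq-cong sq-n!)) ⟨
    sq E-evens * (sq (+ 3 * 3^m) * T p (+ 1) * sq (sq (+ (n !))))
      ≡⟨ cong (λ k → sq E-evens * (sq (+ 3 * 3^m) * T p (+ 1) * sq (sq k))) evens*odds≡n! ⟨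
    sq E-evens * (sq (+ 3 * 3^m) * T p (+ 1) * sq (sq (evens * odds)))
      ≡⟨ rearrange E-evens (+ 3 * 3^m) (T p (+ 1)) evens odds ⟩
    T p (+ 1) * sq (+ 3 * 3^m * odds * E-evens * odds) * sq (evens * evens)
      ≈⟨ *-congʳ (sq (evens * evens)) T⁺ ⟩
    sq (+ 2 * 2^m * E-odds) * sq (evens * evens)
      ≡⟨ cong (λ o → sq (+ 2 * 2^m * o) * sq (evens * evens)) E-odds≡ ⟩
    sq (+ 2 * 2^m * (E-evens * + (n !))) * sq (evens * evens)
      ≡⟨ regroup (+ 2 * 2^m) E-evens (+ (n !)) evens ⟩
    sq E-evens * (sq (+ 2 * 2^m * evens * evens) * sq (+ (n !)))
      ≈⟨ *-congˡ (sq E-evens) (*-congˡ (sq (+ 2 * 2^m * evens * evens)) sq-n!) ⟩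
    sq E-evens * (sq (+ 2 * 2^m * evens * evens) * + 1)
      ≡⟨ cong (sq E-evens *_) (ℤP.*-identityʳ _) ⟩
    sq E-evens * sq (+ 2 * 2^m * evens * evens) ∎))
    where
    open ≈-Reasoning
    rearrange : ∀ e b t v d → (e * e) * ((b * b) * t * (((v * d) * (v * d)) * ((v * d) * (v * d)))) ≡
      t * ((b * d * e * d) * (b * d * e * d)) * ((v * v) * (v * v))
    rearrange = solve-∀
    regroup : ∀ a e k v → ((a * (e * k)) * (a * (e * k))) * ((v * v) * (v * v)) ≡ (e * e) * (((a * v * v) * (a * v * v)) * (k * k))
    regroup = solve-∀

  private
    B : ℤ
    B = + ((m ℕ.+ m) C m)

  -- The argument of the square is (2m)! = n!/n. Since 2n ≡ -1 and n!² ≡ 1, its square is 1/n² ≡ 4.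
  sq-B : sq (B * (m! * m!)) ≈ + 4
  sq-B = begin
    sq (B * (m! * m!))                  ≡⟨ cong sq (central-binomial m) ⟩
    sq (+ ((m ℕ.+ m) !))                ≡⟨ ℤP.*-identityˡ _ ⟨
    sq (- + 1) * sq (+ ((m ℕ.+ m) !))   ≈⟨ *-congʳ _ (sq-cong 2n≈-1) ⟨
    sq (+ 2 * + n) * sq (+ ((m ℕ.+ m) !))   ≡⟨ rearrange (+ n) (+ ((m ℕ.+ m) !)) ⟩
    + 4 * sq (+ n * + ((m ℕ.+ m) !))    ≡⟨ cong (λ k → + 4 * sq k) (suc-! (m ℕ.+ m)) ⟨
    + 4 * sq (+ (n !))                  ≈⟨ *-congˡ (+ 4) sq-n! ⟩
    + 4                                 ∎
    where
    open ≈-Reasoning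
    rearrange : ∀ a b → ((+ 2 * a) * (+ 2 * a)) * (b * b) ≡ + 4 * ((a * b) * (a * b))
    rearrange = solve-∀
    2n≈-1 : + 2 * + n ≈ - + 1
    2n≈-1 = ≈-trans (≈-reflexive (double-suc (m ℕ.+ m))) (complement (even+ (m ℕ.+ m)) 1
      (trans (ℕP.+-comm _ 1) (trans (cong (suc ∘ suc) (sym (ℕP.+-suc (m ℕ.+ m) (m ℕ.+ m)))) (sym p≡4m+3))))

  ^n : ∀ a → a ^ n ≡ a * sq (a ^ m)
  ^n a = cong (a *_) (ℤP.^-distribˡ-+-* a m m)

  legendre-6 : legendre (+ 6) p ≈ + 6 * sq (3^m * 2^m)
  legendre-6 = begin
    legendre (+ 6) p                 ≈⟨ legendre-euler n p≡4m+3 (*≉0 2≉0 3≉0) ⟩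
    (+ 6) ^ n                        ≡⟨ ^n (+ 6) ⟩
    + 6 * sq ((+ 6) ^ m)             ≡⟨ cong (λ c → + 6 * sq c) (^-distribʳ-* m (+ 3) (+ 2)) ⟩
    + 6 * sq (3^m * 2^m)             ∎
    where open ≈-Reasoning

  fermat-half : ∀ {a} → a ≉ + 0 → sq (a * sq (a ^ m)) ≈ + 1
  fermat-half {a} a≉0 = subst (λ c → sq c ≈ + 1) (^n a) (fermat n p≡4m+3 a≉0)

  -- Multiplied by the coefficient of T in `T⁻-value`, the right-hand side must become -1: `sq-B`
  -- absorbs the binomial coefficient, and Fermat's theorem for 6 the powers.
  T⁻-binomial : ∀ inv2 → + 2 * inv2 ≈ + 1 →
    T p (- + 1) ≈ legendre (+ 6) p * - + 1 * inv2 * + 3 * (B ^ 2)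
  T⁻-binomial inv2 2inv2≈1 = *-cancelˡ (sq (3^m * 2^m * (m! * m!))) (*≉0 c≉0 c≉0) (≈-trans T⁻-value (≈-sym (begin
    sq (3^m * 2^m * (m! * m!)) * (legendre (+ 6) p * - + 1 * inv2 * + 3 * (B ^ 2))
      ≈⟨ *-congˡ (sq (3^m * 2^m * (m! * m!))) (*-congʳ (B ^ 2) (*-congʳ (+ 3) (*-congʳ inv2 (*-congʳ (- + 1) legendre-6)))) ⟩
    sq (3^m * 2^m * (m! * m!)) * (+ 6 * sq (3^m * 2^m) * - + 1 * inv2 * + 3 * (B ^ 2))
      ≡⟨ rearrange (3^m * 2^m) m! inv2 B ⟩
    - (sq (3^m * 2^m) * (+ 6 * sq (3^m * 2^m)) * + 3 * inv2 * sq (B * (m! * m!)))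
      ≈⟨ -‿cong (*-congˡ (sq (3^m * 2^m) * (+ 6 * sq (3^m * 2^m)) * + 3 * inv2) sq-B) ⟩
    - (sq (3^m * 2^m) * (+ 6 * sq (3^m * 2^m)) * + 3 * inv2 * + 4)
      -- The constants 6 · 3 · 4 = 72 are split as 6² · 2.
      ≡⟨ regroup (sq (3^m * 2^m)) inv2 ⟩
    - (sq (+ 6 * sq (3^m * 2^m)) * (+ 2 * inv2))
      ≈⟨ -‿cong (*-cong fermat-6 2inv2≈1) ⟩
    - + 1 ∎)))
    where
    open ≈-Reasoning
    c≉0 : 3^m * 2^m * (m! * m!) ≉ + 0
    c≉0 = *≉0 (*≉0 (^≉0 m 3≉0) (^≉0 m 2≉0)) (*≉0 m!≉0 m!≉0)
    fermat-6 : sq (+ 6 * sq (3^m * 2^m)) ≈ + 1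
    fermat-6 = subst (λ c → sq (+ 6 * sq c) ≈ + 1) (^-distribʳ-* m (+ 3) (+ 2)) (fermat-half (*≉0 2≉0 3≉0))
    rearrange : ∀ c f i b → ((c * (f * f)) * (c * (f * f))) * (+ 6 * (c * c) * - + 1 * i * + 3 * (b * (b * + 1))) ≡
      - ((c * c) * (+ 6 * (c * c)) * + 3 * i * ((b * (f * f)) * (b * (f * f))))
    rearrange = solve-∀
    regroup : ∀ s i → - (s * (+ 6 * s) * + 3 * i * + 4) ≡ - (((+ 6 * s) * (+ 6 * s)) * (+ 2 * i))
    regroup = solve-∀

  T⁺-binomial : ∀ inv3 invB → + 3 * inv3 ≈ + 1 → B * invB ≈ + 1 →
    T p (+ 1) ≈ legendre (+ 6) p * + 2 * inv3 * (invB * invB)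
  T⁺-binomial inv3 invB 3inv3≈1 BinvB≈1 = *-cancelˡ (sq (+ 3 * 3^m)) (*≉0 c≉0 c≉0) (begin
    sq (+ 3 * 3^m) * T p (+ 1)
      ≈⟨ T⁺-value ⟩
    sq (+ 2 * 2^m * (2^m * m!) * (2^m * m!))
      ≡⟨ rearrange 2^m m! ⟩
    sq (+ 2 * sq 2^m) * sq 2^m * sq (m! * m!)
      ≈⟨ *-cong (*-congʳ (sq 2^m) (fermat-half 2≉0)) m!⁴ ⟩
    + 1 * sq 2^m * (+ 4 * sq invB)
      ≡⟨ regroup₁ (sq 2^m) (sq invB) ⟩
    + 1 * + 1 * (sq 2^m * (+ 4 * sq invB))
      -- The two ones become (3^n)² and 3 · `inv3`, to match the coefficient 3^(2m+2), the Legendre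
      -- symbol and the factor 1/3 of the target.
      ≈⟨ *-congʳ _ (*-cong (fermat-half 3≉0) 3inv3≈1) ⟨
    sq (+ 3 * sq 3^m) * (+ 3 * inv3) * (sq 2^m * (+ 4 * sq invB))
      ≡⟨ regroup₂ 3^m 2^m inv3 invB ⟩
    sq (+ 3 * 3^m) * (+ 6 * sq (3^m * 2^m) * + 2 * inv3 * (invB * invB))
      ≈⟨ *-congˡ (sq (+ 3 * 3^m)) (*-congʳ (invB * invB) (*-congʳ inv3 (*-congʳ (+ 2) legendre-6))) ⟨
    sq (+ 3 * 3^m) * (legendre (+ 6) p * + 2 * inv3 * (invB * invB)) ∎)
    where
    open ≈-Reasoning
    c≉0 : + 3 * 3^m ≉ + 0
    c≉0 = ^≉0 (suc m) 3≉0
    m!⁴ : sq (m! * m!) ≈ + 4 * sq invB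
    m!⁴ = begin
      sq (m! * m!)                             ≡⟨ ℤP.*-identityʳ _ ⟨
      sq (m! * m!) * sq (+ 1)                  ≈⟨ *-congˡ (sq (m! * m!)) (sq-cong BinvB≈1) ⟨
      sq (m! * m!) * sq (B * invB)             ≡⟨ swap B invB (m! * m!) ⟩
      sq (B * (m! * m!)) * sq invB             ≈⟨ *-congʳ (sq invB) sq-B ⟩
      + 4 * sq invB                            ∎
      where
      swap : ∀ b i f → (f * f) * ((b * i) * (b * i)) ≡ ((b * f) * (b * f)) * (i * i)
      swap = solve-∀
    rearrange : ∀ a f → (+ 2 * a * (a * f) * (a * f)) * (+ 2 * a * (a * f) * (a * f)) ≡
      ((+ 2 * (a * a)) * (+ 2 * (a * a))) * (a * a) * ((f * f) * (f * f))
    rearrange = solve-∀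
    regroup₁ : ∀ a i → + 1 * a * (+ 4 * i) ≡ + 1 * + 1 * (a * (+ 4 * i))
    regroup₁ = solve-∀
    regroup₂ : ∀ b a j i → ((+ 3 * (b * b)) * (+ 3 * (b * b))) * (+ 3 * j) * ((a * a) * (+ 4 * (i * i))) ≡
      ((+ 3 * b) * (+ 3 * b)) * (+ 6 * ((b * a) * (b * a)) * + 2 * j * (i * i))
    regroup₂ = solve-∀

-- Powers of three

module PowerOfThree (p : ℕ) (prime : Prime p) where
  open PrimeModulus p prime

  -- The three stretches of i correspond to 3i in (0, p/2), (p/2, p) and (p, 3p/2).
  3^n-by-residues : ∀ a b (x y : ℕ → ℕ) → a ℕ.+ (b ℕ.+ b) ℕ.< p →
    (∀ i q → suc (i ℕ.+ q) ≡ b → 3 ℕ.* suc (a ℕ.+ i) ℕ.+ x q ≡ p) →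
    (∀ q → 3 ℕ.* suc (a ℕ.+ (b ℕ.+ q)) ≡ y q ℕ.+ p) →
    ∏ a (λ i → + 3 * + suc i) * (∏ b (+_ ∘ x) * ∏ b (+_ ∘ y)) ≡ + ((a ℕ.+ (b ℕ.+ b)) !) →
    (+ 3) ^ (a ℕ.+ (b ℕ.+ b)) ≈ (- + 1) ^ b
  3^n-by-residues a b x y n<p middle upper residues-! = *-cancelˡ (+ (n !)) (!≉0 n n<p) (begin
    + (n !) * (+ 3) ^ n                          ≡⟨ ℤP.*-comm (+ (n !)) _ ⟩
    (+ 3) ^ n * + (n !)                          ≡⟨ cong₂ _*_ (∏-const n (+ 3)) (∏-! n) ⟨
    ∏ n (λ _ → + 3) * ∏ n (+_ ∘ suc)             ≡⟨ ∏-distrib-* n (λ _ → + 3) (+_ ∘ suc) ⟨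
    ∏ n triple                                   ≡⟨ trans (∏-+ a (b ℕ.+ b) triple) (cong (∏ a triple *_) (∏-+ b b (λ i → triple (a ℕ.+ i)))) ⟩
    ∏ a triple * (∏ b (λ i → triple (a ℕ.+ i)) * ∏ b (λ q → triple (a ℕ.+ (b ℕ.+ q))))
      -- In the middle stretch p - 3i falls as i grows, so it is read backwards to make `x`
      -- increasing.
      ≡⟨ cong (λ c → ∏ a triple * (c * ∏ b (λ q → triple (a ℕ.+ (b ℕ.+ q)))))
           (∏-reverse b (λ i → triple (a ℕ.+ i)) (λ q → triple (a ℕ.+ (b ∸ suc q)))
             (λ i q eq → cong (λ k → triple (a ℕ.+ k)) (trans (sym (ℕP.m+n∸n≡m i q)) (cong (_∸ suc q) eq)))) ⟩
    ∏ a triple * (∏ b (λ q → triple (a ℕ.+ (b ∸ suc q))) * ∏ b (λ q → triple (a ℕ.+ (b ℕ.+ q))))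
      ≈⟨ *-congˡ (∏ a triple) (*-cong (∏-cong b (λ q q<b → reflected q<b)) (∏-cong b (λ q _ → shifted q))) ⟩
    ∏ a triple * (∏ b (λ q → - + 1 * + x q) * ∏ b (+_ ∘ y))
      ≡⟨ cong (λ c → ∏ a triple * (c * ∏ b (+_ ∘ y))) (trans (∏-distrib-* b (λ _ → - + 1) (+_ ∘ x)) (cong (_* ∏ b (+_ ∘ x)) (∏-const b (- + 1)))) ⟩
    ∏ a triple * ((- + 1) ^ b * ∏ b (+_ ∘ x) * ∏ b (+_ ∘ y))
      ≡⟨ rearrange (∏ a triple) ((- + 1) ^ b) (∏ b (+_ ∘ x)) (∏ b (+_ ∘ y)) ⟩
    ∏ a triple * (∏ b (+_ ∘ x) * ∏ b (+_ ∘ y)) * (- + 1) ^ b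
      ≡⟨ cong (_* (- + 1) ^ b) residues-! ⟩
    + (n !) * (- + 1) ^ b ∎)
    where
    open ≈-Reasoning
    n : ℕ
    n = a ℕ.+ (b ℕ.+ b)
    triple : ℕ → ℤ
    triple i = + 3 * + suc i
    rearrange : ∀ t s x y → t * (s * x * y) ≡ t * (x * y) * s
    rearrange = solve-∀
    cancel : ∀ t x → t ≡ (t + x) - x
    cancel = solve-∀
    reflected : ∀ {q} → q ℕ.< b → triple (a ℕ.+ (b ∸ suc q)) ≈ - + 1 * + x q
    reflected {q} q<b = begin
      triple i                ≡⟨ cancel (triple i) (+ x q) ⟩
      triple i + + x q - + x q  ≡⟨ cong (λ c → c + + x q - + x q) (ℤP.pos-* 3 (suc i)) ⟨
      + (3 ℕ.* suc i ℕ.+ x q) - + x q  ≡⟨ cong (λ k → + k - + x q) (middle (b ∸ suc q) q (trans (sym (ℕP.+-suc (b ∸ suc q) q)) (ℕP.m∸n+n≡m q<b))) ⟩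
      + p - + x q             ≈⟨ +-cong p≈0 (≈-refl { - + x q}) ⟩
      + 0 - + x q             ≡⟨ ℤP.+-identityˡ _ ⟩
      - + x q                 ≡⟨ ℤP.-1*i≡-i (+ x q) ⟨
      - + 1 * + x q           ∎
      where
      i : ℕ
      i = a ℕ.+ (b ∸ suc q)
    shifted : ∀ q → triple (a ℕ.+ (b ℕ.+ q)) ≈ + y q
    shifted q = begin
      triple (a ℕ.+ (b ℕ.+ q))           ≡⟨ ℤP.pos-* 3 (suc (a ℕ.+ (b ℕ.+ q))) ⟨
      + (3 ℕ.* suc (a ℕ.+ (b ℕ.+ q)))    ≡⟨ cong +_ (upper q) ⟩
      + y q + + p                        ≈⟨ +-cong (≈-refl {+ y q}) p≈0 ⟩
      + y q + + 0                        ≡⟨ ℤP.+-identityʳ (+ y q) ⟩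
      + y q                              ∎

  private
    3q+1 3q+2 : ℕ → ℕ
    3q+1 q = suc (3 ℕ.* q)
    3q+2 q = suc (suc (3 ℕ.* q))

  -- The numbers from 1 to 3a sorted by residue modulo 3; each induction step adds 3a+1, 3a+2 and
  -- 3a+3.
  residues-mod-3-! : ∀ a → ∏ a (λ i → + 3 * + suc i) * (∏ a (+_ ∘ 3q+1) * ∏ a (+_ ∘ 3q+2)) ≡ + ((a ℕ.+ (a ℕ.+ a)) !)
  residues-mod-3-! zero    = refl
  residues-mod-3-! (suc a) = begin
    ∏ (suc a) t * (∏ (suc a) (+_ ∘ 3q+1) * ∏ (suc a) (+_ ∘ 3q+2))
      ≡⟨ cong₂ _*_ (∏-last a t) (cong₂ _*_ (∏-last a (+_ ∘ 3q+1)) (∏-last a (+_ ∘ 3q+2))) ⟩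
    ∏ a t * t a * (∏ a (+_ ∘ 3q+1) * + 3q+1 a * (∏ a (+_ ∘ 3q+2) * + 3q+2 a))
      ≡⟨ rearrange (∏ a t) (t a) (∏ a (+_ ∘ 3q+1)) (+ 3q+1 a) (∏ a (+_ ∘ 3q+2)) (+ 3q+2 a) ⟩
    t a * (+ 3q+2 a * (+ 3q+1 a * (∏ a t * (∏ a (+_ ∘ 3q+1) * ∏ a (+_ ∘ 3q+2)))))
      ≡⟨ cong₂ (λ c d → c * (+ 3q+2 a * (+ 3q+1 a * d))) t-a (trans (residues-mod-3-! a) (cong (+_ ∘ _!) (identity a))) ⟩
    + suc (3q+2 a) * (+ 3q+2 a * (+ 3q+1 a * + ((3 ℕ.* a) !)))
      ≡⟨ trans (suc-! (3q+2 a)) (cong (+ suc (3q+2 a) *_) (trans (suc-! (3q+1 a)) (cong (+ 3q+2 a *_) (suc-! (3 ℕ.* a))))) ⟨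
    + (suc (3q+2 a) !)
      ≡⟨ cong (+_ ∘ _!) (identity′ a) ⟩
    + ((suc a ℕ.+ (suc a ℕ.+ suc a)) !) ∎
    where
    open ≡-Reasoning
    t : ℕ → ℤ
    t i = + 3 * + suc i
    rearrange : ∀ t u v w x y → t * u * (v * w * (x * y)) ≡ u * (y * (w * (t * (v * x))))
    rearrange = solve-∀
    identity : ∀ a → a ℕ.+ (a ℕ.+ a) ≡ 3 ℕ.* a
    identity = ℕSolver.solve-∀
    identity′ : ∀ a → suc (suc (suc (3 ℕ.* a))) ≡ suc a ℕ.+ (suc a ℕ.+ suc a)
    identity′ = ℕSolver.solve-∀
    identity″ : ∀ a → 3 ℕ.* suc a ≡ suc (suc (suc (3 ℕ.* a)))
    identity″ = ℕSolver.solve-∀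
    t-a : t a ≡ + suc (3q+2 a)
    t-a = trans (sym (ℤP.pos-* 3 (suc a))) (cong +_ (identity″ a))

  -- As p ≡ 1 modulo 3, the values p - 3i are the numbers 3q+1 and the values 3i - p the numbers
  -- 3q+2; with the multiples of 3 they exhaust 1, ..., 3a.
  3^n-6a+1 : ∀ a → p ≡ suc (6 ℕ.* a) → (+ 3) ^ (a ℕ.+ (a ℕ.+ a)) ≈ (- + 1) ^ a
  3^n-6a+1 a p≡ = 3^n-by-residues a a 3q+1 3q+2
    (subst (a ℕ.+ (a ℕ.+ a) ℕ.<_) (sym p≡) (ℕ.s≤s (subst (a ℕ.+ (a ℕ.+ a) ℕ.≤_) (size a) (ℕP.m≤m+n _ (a ℕ.+ (a ℕ.+ a))))))
    (λ { i q refl → trans (middle i q) (sym p≡) })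
    (λ q → trans (upper a q) (cong (3q+2 q ℕ.+_) (sym p≡)))
    (residues-mod-3-! a)
    where
    size : ∀ a → a ℕ.+ (a ℕ.+ a) ℕ.+ (a ℕ.+ (a ℕ.+ a)) ≡ 6 ℕ.* a
    size = ℕSolver.solve-∀
    middle : ∀ i q → 3 ℕ.* suc (suc (i ℕ.+ q) ℕ.+ i) ℕ.+ suc (3 ℕ.* q) ≡ suc (6 ℕ.* suc (i ℕ.+ q))
    middle = ℕSolver.solve-∀
    upper : ∀ a q → 3 ℕ.* suc (a ℕ.+ (a ℕ.+ q)) ≡ suc (suc (3 ℕ.* q)) ℕ.+ suc (6 ℕ.* a)
    upper = ℕSolver.solve-∀

  -- As p ≡ 2 modulo 3, the two classes change roles. Up to n = 3a+2 each has one member more than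
  -- the multiples of 3, so `b` is a + 1.
  3^n-6a+5 : ∀ a → p ≡ 5 ℕ.+ 6 ℕ.* a → (+ 3) ^ (a ℕ.+ (suc a ℕ.+ suc a)) ≈ (- + 1) ^ suc a
  3^n-6a+5 a p≡ = 3^n-by-residues a (suc a) 3q+2 3q+1
    (subst (a ℕ.+ (suc a ℕ.+ suc a) ℕ.<_) (trans (size a) (sym p≡)) (ℕ.s≤s (ℕP.m≤m+n _ (suc (suc (a ℕ.+ (a ℕ.+ a)))))))
    (λ i q eq → trans (middle i q eq) (sym p≡))
    (λ q → trans (upper a q) (cong (3q+1 q ℕ.+_) (sym p≡)))
    residues-!
    where
    size : ∀ a → suc (a ℕ.+ (suc a ℕ.+ suc a) ℕ.+ suc (suc (a ℕ.+ (a ℕ.+ a)))) ≡ 5 ℕ.+ 6 ℕ.* a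
    size = ℕSolver.solve-∀
    middle : ∀ i q → suc (i ℕ.+ q) ≡ suc a → 3 ℕ.* suc (a ℕ.+ i) ℕ.+ suc (suc (3 ℕ.* q)) ≡ 5 ℕ.+ 6 ℕ.* a
    middle i q refl = identity i q
      where
      identity : ∀ i q → 3 ℕ.* suc ((i ℕ.+ q) ℕ.+ i) ℕ.+ suc (suc (3 ℕ.* q)) ≡ 5 ℕ.+ 6 ℕ.* (i ℕ.+ q)
      identity = ℕSolver.solve-∀
    upper : ∀ a q → 3 ℕ.* suc (a ℕ.+ (suc a ℕ.+ q)) ≡ suc (3 ℕ.* q) ℕ.+ (5 ℕ.+ 6 ℕ.* a)
    upper = ℕSolver.solve-∀
    residues-! : ∏ a (λ i → + 3 * + suc i) * (∏ (suc a) (+_ ∘ 3q+2) * ∏ (suc a) (+_ ∘ 3q+1)) ≡ + ((a ℕ.+ (suc a ℕ.+ suc a)) !)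
    residues-! = begin
      ∏ a t * (∏ (suc a) (+_ ∘ 3q+2) * ∏ (suc a) (+_ ∘ 3q+1))
        ≡⟨ cong (∏ a t *_) (cong₂ _*_ (∏-last a (+_ ∘ 3q+2)) (∏-last a (+_ ∘ 3q+1))) ⟩
      ∏ a t * (∏ a (+_ ∘ 3q+2) * + 3q+2 a * (∏ a (+_ ∘ 3q+1) * + 3q+1 a))
        ≡⟨ rearrange (∏ a t) (∏ a (+_ ∘ 3q+1)) (+ 3q+1 a) (∏ a (+_ ∘ 3q+2)) (+ 3q+2 a) ⟩
      + 3q+2 a * (+ 3q+1 a * (∏ a t * (∏ a (+_ ∘ 3q+1) * ∏ a (+_ ∘ 3q+2))))
        ≡⟨ cong (λ d → + 3q+2 a * (+ 3q+1 a * d)) (trans (residues-mod-3-! a) (cong (+_ ∘ _!) (identity a))) ⟩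
      + 3q+2 a * (+ 3q+1 a * + ((3 ℕ.* a) !))
        ≡⟨ trans (suc-! (3q+1 a)) (cong (+ 3q+2 a *_) (suc-! (3 ℕ.* a))) ⟨
      + (3q+2 a !)
        ≡⟨ cong (+_ ∘ _!) (identity′ a) ⟩
      + ((a ℕ.+ (suc a ℕ.+ suc a)) !) ∎
      where
      open ≡-Reasoning
      t : ℕ → ℤ
      t i = + 3 * + suc i
      rearrange : ∀ t v w x y → t * (x * y * (v * w)) ≡ y * (w * (t * (v * x)))
      rearrange = solve-∀
      identity : ∀ a → a ℕ.+ (a ℕ.+ a) ≡ 3 ℕ.* a
      identity = ℕSolver.solve-∀
      identity′ : ∀ a → suc (suc (3 ℕ.* a)) ≡ a ℕ.+ (suc a ℕ.+ suc a)
      identity′ = ℕSolver.solve-∀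

-- The sign for p ≡ 1 modulo 4, and the theorem

module _ (p : ℕ) (prime : Prime p) (p>3 : p > 3) where
  open PrimeModulus p prime

  3≉0 : + 3 ≉ + 0
  3≉0 = small≉0 (ℕ.s≤s ℕ.z≤n) p>3

  3∤p : ∀ k → p ≢ k ℕ.* 3
  3∤p k p≡k*3 with prime⇒irreducible prime (ℕD.divides k p≡k*3)
  ... | inj₁ ()
  ... | inj₂ 3≡p = ℕP.<⇒≢ p>3 3≡p

  -- The remainder `r` will be 0 for p = 12k+1 and 4 for p = 12k+5.
  [p+11]/12 : ∀ k r → r / 12 ≡ 0 → p ℕ.+ 11 ≡ r ℕ.+ suc k ℕ.* 12 → (p ℕ.+ 11) / 12 ≡ suc k
  [p+11]/12 k r r/12≡0 p+11≡ = begin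
    (p ℕ.+ 11) / 12              ≡⟨ cong (_/ 12) p+11≡ ⟩
    (r ℕ.+ suc k ℕ.* 12) / 12    ≡⟨ +-distrib-/-∣ʳ r (ℕD.n∣m*n (suc k)) ⟩
    r / 12 ℕ.+ suc k ℕ.* 12 / 12 ≡⟨ cong₂ ℕ._+_ r/12≡0 (m*n/n≡m (suc k) 12) ⟩
    suc k                        ∎
    where open ≡-Reasoning

  [-1]^3k : ∀ k → (- + 1) ^ (k ℕ.* 3) ≡ (- + 1) ^ k
  [-1]^3k k = begin
    (- + 1) ^ (k ℕ.* 3)                 ≡⟨ cong ((- + 1) ^_) (identity k) ⟩
    (- + 1) ^ (k ℕ.+ (k ℕ.+ k))         ≡⟨ ℤP.^-distribˡ-+-* (- + 1) k (k ℕ.+ k) ⟩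
    (- + 1) ^ k * (- + 1) ^ (k ℕ.+ k)   ≡⟨ cong ((- + 1) ^ k *_) ([-1]^2m≡1 k) ⟩
    (- + 1) ^ k * + 1                   ≡⟨ ℤP.*-identityʳ _ ⟩
    (- + 1) ^ k                         ∎
    where
    open ≡-Reasoning
    identity : ∀ k → k ℕ.* 3 ≡ k ℕ.+ (k ℕ.+ k)
    identity = ℕSolver.solve-∀

  -- With p = 4m+1, the residue of m modulo 3 fixes p modulo 12. For m = 3k and m = 3k+1 the signs
  -- of 2^n and 3^n combine to (-1)^(3k+1) = (-1)^(k+1), and k + 1 is the floor in question.
  sign-from-powers : ∀ m → p ≡ suc ((m ℕ.+ m) ℕ.+ (m ℕ.+ m)) → ∀ x →
    x * (+ 3) ^ (m ℕ.+ m) ≈ - ((+ 2) ^ (m ℕ.+ m)) → x ≈ (- + 1) ^ ((p ℕ.+ 11) / 12)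
  sign-from-powers m p≡4m+1 x x*3^n≈-2^n = by-residue (m % 3) (m / 3) (m≡m%n+[m/n]*n m 3) (m%n<n m 3)
    where
    open ≈-Reasoning
    open PowerOfThree p prime

    x*3^n : x * (+ 3) ^ (m ℕ.+ m) ≈ - ((- + 1) ^ m)
    x*3^n = ≈-trans x*3^n≈-2^n (-‿cong (EvenCase.2^n p prime m p≡4m+1 3≉0))

    conclude : ∀ k r → r / 12 ≡ 0 → p ℕ.+ 11 ≡ r ℕ.+ suc k ℕ.* 12 →
      x ≈ (- + 1) ^ suc (k ℕ.* 3) → x ≈ (- + 1) ^ ((p ℕ.+ 11) / 12)
    conclude k r r/12≡0 p+11≡ x≈ = ≈-trans x≈ (≈-reflexive
      (trans (cong (- + 1 *_) ([-1]^3k k)) (cong ((- + 1) ^_) (sym ([p+11]/12 k r r/12≡0 p+11≡)))))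

    by-residue : ∀ r k → m ≡ r ℕ.+ k ℕ.* 3 → r ℕ.< 3 → x ≈ (- + 1) ^ ((p ℕ.+ 11) / 12)
    by-residue 0 k m≡ _ = conclude k 0 refl
      (trans (cong (ℕ._+ 11) (trans p≡4m+1 (cong (λ m → suc ((m ℕ.+ m) ℕ.+ (m ℕ.+ m))) m≡))) (p+11≡ k))
      (begin
        x                                    ≡⟨ ℤP.*-identityʳ x ⟨
        x * + 1                              ≈⟨ *-congˡ x 3^n≈1 ⟨
        x * (+ 3) ^ (m ℕ.+ m)                ≈⟨ x*3^n ⟩
        - ((- + 1) ^ m)                      ≡⟨ cong (λ m → - ((- + 1) ^ m)) m≡ ⟩
        - ((- + 1) ^ (k ℕ.* 3))              ≡⟨ ℤP.-1*i≡-i _ ⟨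
        (- + 1) ^ suc (k ℕ.* 3)              ∎)
      where
      p+11≡ : ∀ k → suc ((k ℕ.* 3 ℕ.+ k ℕ.* 3) ℕ.+ (k ℕ.* 3 ℕ.+ k ℕ.* 3)) ℕ.+ 11 ≡ suc k ℕ.* 12
      p+11≡ = ℕSolver.solve-∀
      n≡3a : ∀ k → k ℕ.* 3 ℕ.+ k ℕ.* 3 ≡ (k ℕ.+ k) ℕ.+ ((k ℕ.+ k) ℕ.+ (k ℕ.+ k))
      n≡3a = ℕSolver.solve-∀
      p≡6a+1 : ∀ k → suc ((k ℕ.* 3 ℕ.+ k ℕ.* 3) ℕ.+ (k ℕ.* 3 ℕ.+ k ℕ.* 3)) ≡ suc (6 ℕ.* (k ℕ.+ k))
      p≡6a+1 = ℕSolver.solve-∀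
      3^n≈1 : (+ 3) ^ (m ℕ.+ m) ≈ + 1
      3^n≈1 = begin
        (+ 3) ^ (m ℕ.+ m)                                          ≡⟨ cong ((+ 3) ^_) (trans (cong (λ m → m ℕ.+ m) m≡) (n≡3a k)) ⟩
        (+ 3) ^ ((k ℕ.+ k) ℕ.+ ((k ℕ.+ k) ℕ.+ (k ℕ.+ k)))          ≈⟨ 3^n-6a+1 (k ℕ.+ k) (trans p≡4m+1 (trans (cong (λ m → suc ((m ℕ.+ m) ℕ.+ (m ℕ.+ m))) m≡) (p≡6a+1 k))) ⟩
        (- + 1) ^ (k ℕ.+ k)                                        ≡⟨ [-1]^2m≡1 k ⟩
        + 1                                                        ∎
    by-residue 1 k m≡ _ = conclude k 4 refl
      (trans (cong (ℕ._+ 11) (trans p≡4m+1 (cong (λ m → suc ((m ℕ.+ m) ℕ.+ (m ℕ.+ m))) m≡))) (p+11≡ k))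
      (begin
        x                                    ≡⟨ double-negation x ⟩
        - (x * - + 1)                        ≈⟨ -‿cong (*-congˡ x 3^n≈-1) ⟨
        - (x * (+ 3) ^ (m ℕ.+ m))            ≈⟨ -‿cong x*3^n ⟩
        - - ((- + 1) ^ m)                    ≡⟨ ℤP.neg-involutive _ ⟩
        (- + 1) ^ m                          ≡⟨ cong ((- + 1) ^_) m≡ ⟩
        (- + 1) ^ suc (k ℕ.* 3)              ∎)
      where
      double-negation : ∀ x → x ≡ - (x * - + 1)
      double-negation = solve-∀
      p+11≡ : ∀ k → suc ((suc (k ℕ.* 3) ℕ.+ suc (k ℕ.* 3)) ℕ.+ (suc (k ℕ.* 3) ℕ.+ suc (k ℕ.* 3))) ℕ.+ 11 ≡ 4 ℕ.+ suc k ℕ.* 12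
      p+11≡ = ℕSolver.solve-∀
      n≡3a+2 : ∀ k → suc (k ℕ.* 3) ℕ.+ suc (k ℕ.* 3) ≡ (k ℕ.+ k) ℕ.+ (suc (k ℕ.+ k) ℕ.+ suc (k ℕ.+ k))
      n≡3a+2 = ℕSolver.solve-∀
      p≡6a+5 : ∀ k → suc ((suc (k ℕ.* 3) ℕ.+ suc (k ℕ.* 3)) ℕ.+ (suc (k ℕ.* 3) ℕ.+ suc (k ℕ.* 3))) ≡ 5 ℕ.+ 6 ℕ.* (k ℕ.+ k)
      p≡6a+5 = ℕSolver.solve-∀
      3^n≈-1 : (+ 3) ^ (m ℕ.+ m) ≈ - + 1
      3^n≈-1 = begin
        (+ 3) ^ (m ℕ.+ m)                                              ≡⟨ cong ((+ 3) ^_) (trans (cong (λ m → m ℕ.+ m) m≡) (n≡3a+2 k)) ⟩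
        (+ 3) ^ ((k ℕ.+ k) ℕ.+ (suc (k ℕ.+ k) ℕ.+ suc (k ℕ.+ k)))      ≈⟨ 3^n-6a+5 (k ℕ.+ k) (trans p≡4m+1 (trans (cong (λ m → suc ((m ℕ.+ m) ℕ.+ (m ℕ.+ m))) m≡) (p≡6a+5 k))) ⟩
        (- + 1) ^ suc (k ℕ.+ k)                                        ≡⟨ cong (- + 1 *_) ([-1]^2m≡1 k) ⟩
        - + 1                                                          ∎
    -- Here p = 12k + 9 is divisible by 3.
    by-residue 2 k m≡ _ = contradiction
      (trans p≡4m+1 (trans (cong (λ m → suc ((m ℕ.+ m) ℕ.+ (m ℕ.+ m))) m≡) (p≡3l k)))
      (3∤p (3 ℕ.+ 4 ℕ.* k))
      where
      p≡3l : ∀ k → suc ((2 ℕ.+ k ℕ.* 3 ℕ.+ (2 ℕ.+ k ℕ.* 3)) ℕ.+ (2 ℕ.+ k ℕ.* 3 ℕ.+ (2 ℕ.+ k ℕ.* 3))) ≡ (3 ℕ.+ 4 ℕ.* k) ℕ.* 3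
      p≡3l = ℕSolver.solve-∀
    by-residue (suc (suc (suc _))) k m≡ (ℕ.s≤s (ℕ.s≤s (ℕ.s≤s ())))

  p≡4m+1 : p % 4 ≡ 1 → p ≡ suc ((p / 4 ℕ.+ p / 4) ℕ.+ (p / 4 ℕ.+ p / 4))
  p≡4m+1 p%4≡1 = trans (m≡m%n+[m/n]*n p 4) (trans (cong (ℕ._+ p / 4 ℕ.* 4) p%4≡1) (identity (p / 4)))
    where
    identity : ∀ m → 1 ℕ.+ m ℕ.* 4 ≡ suc ((m ℕ.+ m) ℕ.+ (m ℕ.+ m))
    identity = ℕSolver.solve-∀

  p≡4m+3 : p % 4 ≡ 3 → p ≡ 3 ℕ.+ p / 4 ℕ.* 4
  p≡4m+3 p%4≡3 = trans (m≡m%n+[m/n]*n p 4) (cong (ℕ._+ p / 4 ℕ.* 4) p%4≡3)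

  binomial-arguments : ∀ m → p ≡ 3 ℕ.+ m ℕ.* 4 → ((p ∸ 3) / 2) C ((p ∸ 3) / 4) ≡ (m ℕ.+ m) C m
  binomial-arguments m p≡ = cong₂ _C_
    (trans (cong (λ q → (q ∸ 3) / 2) p≡) (trans (cong (_/ 2) (identity m)) (m*n/n≡m (m ℕ.+ m) 2)))
    (trans (cong (λ q → (q ∸ 3) / 4) p≡) (m*n/n≡m m 4))
    where
    identity : ∀ m → m ℕ.* 4 ≡ (m ℕ.+ m) ℕ.* 2
    identity = ℕSolver.solve-∀

theorem1p6 : (p : ℕ) → Prime p → p > 3 → (δ : ℤ) → (δ ≡ + 1 ⊎ δ ≡ - (+ 1)) →
    (p % 4 ≡ 1 → T p δ ≡ (- (+ 1)) ^ ((p ℕ.+ 11) / 12) [mod p ]) ×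
    (p % 4 ≡ 3 →
    ((δ ≡ + 1 → (inv3 invB : ℤ) → (+ 3) * inv3 ≡ + 1 [mod p ] →
    (+ ((p ∸ 3) / 2 C ((p ∸ 3) / 4))) * invB ≡ + 1 [mod p ] →
    T p δ ≡ legendre (+ 6) p * (+ 2) * inv3 * (invB * invB) [mod p ]) ×
    (δ ≡ - (+ 1) → (inv2 : ℤ) → (+ 2) * inv2 ≡ + 1 [mod p ] →
    T p δ ≡ legendre (+ 6) p * (- (+ 1)) * inv2 * (+ 3)
    * ((+ ((p ∸ 3) / 2 C ((p ∸ 3) / 4))) ^ 2) [mod p ])))
theorem1p6 p pr p>3 δ δ≡±1 = case-1 δ≡±1 , λ p%4≡3 → case-3⁺ p%4≡3 , case-3⁻ p%4≡3
  where
  open PrimeModulus p pr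
  m : ℕ
  m = p / 4

  case-1 : δ ≡ + 1 ⊎ δ ≡ - (+ 1) → p % 4 ≡ 1 → T p δ ≡ (- (+ 1)) ^ ((p ℕ.+ 11) / 12) [mod p ]
  case-1 (inj₁ refl) p%4≡1 = ≈⇒≡[mod] (sign-from-powers p pr p>3 m (p≡4m+1 p pr p>3 p%4≡1) (T p (+ 1))
    (EvenCase.T⁺*3^n p pr m (p≡4m+1 p pr p>3 p%4≡1) (3≉0 p pr p>3)))
  case-1 (inj₂ refl) p%4≡1 = ≈⇒≡[mod] (sign-from-powers p pr p>3 m (p≡4m+1 p pr p>3 p%4≡1) (T p (- + 1))
    (EvenCase.T⁻*3^n p pr m (p≡4m+1 p pr p>3 p%4≡1) (3≉0 p pr p>3)))

  module _ (p%4≡3 : p % 4 ≡ 3) where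
    shape : p ≡ suc (suc (m ℕ.+ m) ℕ.+ suc (m ℕ.+ m))
    shape = trans (p≡4m+3 p pr p>3 p%4≡3) (identity m)
      where
      identity : ∀ m → 3 ℕ.+ m ℕ.* 4 ≡ suc (suc (m ℕ.+ m) ℕ.+ suc (m ℕ.+ m))
      identity = ℕSolver.solve-∀

    binomial : ((p ∸ 3) / 2) C ((p ∸ 3) / 4) ≡ (m ℕ.+ m) C m
    binomial = binomial-arguments p pr p>3 m (p≡4m+3 p pr p>3 p%4≡3)

    case-3⁺ : δ ≡ + 1 → (inv3 invB : ℤ) → (+ 3) * inv3 ≡ + 1 [mod p ] →
      (+ ((p ∸ 3) / 2 C ((p ∸ 3) / 4))) * invB ≡ + 1 [mod p ] →
      T p δ ≡ legendre (+ 6) p * (+ 2) * inv3 * (invB * invB) [mod p ]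
    case-3⁺ refl inv3 invB 3inv3≡1 BinvB≡1 = ≈⇒≡[mod]
      (OddCase.T⁺-binomial p pr m shape (3≉0 p pr p>3) inv3 invB (≡[mod]⇒≈ 3inv3≡1)
        (subst (λ c → + c * invB ≈ + 1) binomial (≡[mod]⇒≈ BinvB≡1)))

    case-3⁻ : δ ≡ - (+ 1) → (inv2 : ℤ) → (+ 2) * inv2 ≡ + 1 [mod p ] →
      T p δ ≡ legendre (+ 6) p * (- (+ 1)) * inv2 * (+ 3) * ((+ ((p ∸ 3) / 2 C ((p ∸ 3) / 4))) ^ 2) [mod p ]
    case-3⁻ refl inv2 2inv2≡1 = ≈⇒≡[mod]
      (subst (λ c → T p (- + 1) ≈ legendre (+ 6) p * - + 1 * inv2 * + 3 * ((+ c) ^ 2)) (sym binomial)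
        (OddCase.T⁻-binomial p pr m shape (3≉0 p pr p>3) inv2 (≡[mod]⇒≈ 2inv2≡1)))
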